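{- Let $k,\ell$ be integers with $k,\ell\geq 2$ and $2k\geq \ell$, and let $H$ be an arbitrary graph on $\ell$ vertices that contains a Hamiltonian cycle. Then $$C(C_{2k},H)=\frac{4k(k-1)}{2k\ell-2k-\ell}.$$
   Context: All graphs are finite and simple. $C_m$ denotes the cycle on $m$ vertices (with $C_2=K_2$ by convention). $\operatorname{hom}(H,T)$ is the number of maps $V(H)\to V(T)$ sending every edge of $H$ to an edge of $T$, $t(H,T)=\operatorname{hom}(H,T)/v(T)^{v(H)}$, and $C(G,H)=\min\{c\in\mathbb{R}: t(G,T)\geq t(H,T)^c \text{ for all graphs } T\}$. -}

module Defs where

open import Data.Nat using (ℕ; zero; suc; _+_; _*_; _^_; _%_; _≡ᵇ_)
open import Data.Bool using (Bool; true; false; _∨_; not)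
open import Data.Fin using (Fin; toℕ)
open import Data.Vec using (Vec; []; _∷_; lookup)
open import Data.List.Base using (List; [_]; map; concatMap; all; allFin; filterᵇ; length)
open import Relation.Binary.PropositionalEquality using (_≡_)

record Graph (n : ℕ) : Set where
  field
    adj : Fin n → Fin n → Bool
open Graph public

IsSimple : {n : ℕ} → Graph n → Set
IsSimple {n} G = ((i j : Fin n) → adj G i j ≡ adj G j i) Data.Product.× ((i : Fin n) → adj G i i ≡ false)
  where import Data.Product

-- The cycle C_m on vertices 0,…,m-1: i ~ j iff j ≡ i+1 (mod m) or i ≡ j+1 (mod m).
-- (For m = 2 this is K_2, matching the convention C_2 = K_2.)
cycleG : (m : ℕ) → Graph m
cycleG zero = record { adj = λ () }
cycleG (suc n) = record { adj = λ i j →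
  ((suc (toℕ i) % suc n) ≡ᵇ toℕ j) ∨ ((suc (toℕ j) % suc n) ≡ᵇ toℕ i) }

allMaps : (a b : ℕ) → List (Vec (Fin b) a)
allMaps zero b = [ [] ]
allMaps (suc a) b = concatMap (λ x → map (x ∷_) (allMaps a b)) (allFin b)

isHom : {a b : ℕ} → Graph a → Graph b → Vec (Fin b) a → Bool
isHom {a} H T f =
  all (λ i → all (λ j → not (adj H i j) ∨ adj T (lookup f i) (lookup f j)) (allFin a)) (allFin a)

hom : {a b : ℕ} → Graph a → Graph b → ℕ
hom {a} {b} H T = length (filterᵇ (isHom H T) (allMaps a b))

-- c = p/q (p, q ∈ ℕ, q ≥ 1) is admissible for (G,H): t(G,T) ≥ t(H,T)^(p/q) for
-- every simple graph T on b+1 ≥ 1 vertices.  Written without reals by raising to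
-- the q-th power and clearing denominators:
--   (hom(G,T)/n^{v(G)})^q ≥ (hom(H,T)/n^{v(H)})^p
--   ⇔ hom(H,T)^p · n^{v(G)·q} ≤ hom(G,T)^q · n^{v(H)·p},   n = v(T).
Admissible : {g h : ℕ} → Graph g → Graph h → ℕ → ℕ → Set
Admissible {g} {h} G H p q =
  (b : ℕ) → (T : Graph (suc b)) → IsSimple T →
  hom H T ^ p * suc b ^ (g * q) Data.Nat.≤ hom G T ^ q * suc b ^ (h * p)
  where import Data.Nat

HasHamiltonianCycle : {ℓ : ℕ} → Graph ℓ → Set
HasHamiltonianCycle {ℓ} H =
  Σ (Fin ℓ → Fin ℓ) λ σ → Injective _≡_ _≡_ σ ×
    ((i j : Fin ℓ) → adj (cycleG ℓ) i j ≡ true → adj H (σ i) (σ j) ≡ true)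
  where
  open import Data.Product using (Σ; _×_)
  open import Function.Definitions using (Injective)

{-# OPTIONS --safe #-}
-- Write s m for the trace of the m-th power of the adjacency matrix of T, so that hom(C_m, T) = s m,
-- and n = v(T).
--
-- Upper bound.  A Hamiltonian cycle gives hom(H, T) ≤ s ℓ.  Cauchy–Schwarz gives s (i+j)² ≤ s 2i · s 2j,
-- hence the interpolation (s ℓ)^(2k-2) ≤ (s 2)^(2k-ℓ) (s 2k)^(ℓ-2).  For the numbers w m of walks of
-- length m it gives in the same way (s 2)^(2k) = (w 1)^(2k) ≤ n^k (w 2)^k ≤ n^(2k-1) w 2k ≤ n^(2k) s 2k.
-- Eliminating s 2 yields the exponent of the theorem.
--
-- Sharpness.  Let T have vertex set [ℓ] × [M]^d with M = d^(2k-1), two vertices being adjacent when their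
-- colours in [ℓ] differ and their vectors agree in some coordinate.  A vertex lies in d of the d M classes
-- "coordinate i equals a", and two classes of different coordinates meet independently.  If B is the incidence
-- matrix of vertices and classes, then M² BᵀB ≤ n (M I + J) and so s 2k ≤ tr (BᵀB)^(2k) = O(n^(2k) (d/M)^(2k)),
-- whereas the classes alone contribute Ω(n^ℓ d / M^(ℓ-1)) copies of any graph on ℓ vertices.
-- Comparing powers of d as d → ∞ gives the lower bound on the exponent.
module Submission where

open import Defs
open import Data.Bool using (Bool; true; false; _∧_; _∨_; not)
open import Data.Bool.ListAction using (all)
open import Data.Bool.Properties using (T-≡)
open import Data.Fin using (Fin; zero; suc; toℕ; fromℕ<; punchOut)
open import Data.Fin.Properties using (toℕ<n; toℕ-fromℕ<; toℕ-injective; any?; punchOut-injective; injective⇒≤)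
import Data.Fin.Properties as Fin
open import Data.List.Base using (List; []; _∷_; _++_; map; length; cartesianProductWith; cartesianProduct; concatMap; allFin; tabulate; lookup; filterᵇ)
open import Data.List.Membership.Propositional using (_∈_)
open import Data.List.Membership.Propositional.Properties using (∈-∃++; ∈-++⁻; ∈-++⁺ˡ; ∈-++⁺ʳ; ∈-allFin; ∈-cartesianProductWith⁺)
open import Data.List.Properties using (length-tabulate)
open import Data.List.Relation.Unary.All using ([])
import Data.List.Relation.Unary.All as All
open import Data.List.Relation.Unary.Any using (here; there)
open import Data.List.Relation.Unary.Unique.Propositional using (Unique; []; _∷_)
import Data.List.Relation.Unary.Unique.Propositional.Properties as Unique
open import Data.Nat using (ℕ; zero; suc; _+_; _*_; _^_; _∸_; _≤_; _<_; z≤n; s≤s; NonZero; >-nonZero; >-nonZero⁻¹; _%_; _≡ᵇ_)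
open import Data.Nat.DivMod using (m%n<n; m<n⇒m%n≡m; n%n≡0)
open import Data.Nat.Properties
open import Data.Nat.Tactic.RingSolver using (solve-∀)
open import Data.Product using (_,_; ∃; _×_; proj₂)
open import Data.Sum using (_⊎_; inj₁; inj₂)
open import Data.Vec.Base using (Vec; []; _∷_; _∷ʳ_)
import Data.Vec.Base as Vec
import Data.Vec.Properties as Vec
open import Function.Base using (_∘_; _|>_)
open import Function.Bundles using (Equivalence)
open import Function.Definitions using (Injective)
open import Relation.Binary.PropositionalEquality
open import Relation.Nullary using (¬_; yes; no; contradiction; does)

private
  variable
    A B C D : Set

-- Finite sums

∑ : List A → (A → ℕ) → ℕ
∑ []       f = 0
∑ (x ∷ xs) f = f x + ∑ xs f

∑-cong : ∀ (xs : List A) {f g : A → ℕ} → (∀ x → f x ≡ g x) → ∑ xs f ≡ ∑ xs g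
∑-cong []       eq = refl
∑-cong (x ∷ xs) eq = cong₂ _+_ (eq x) (∑-cong xs eq)

∑-mono : ∀ (xs : List A) {f g : A → ℕ} → (∀ x → f x ≤ g x) → ∑ xs f ≤ ∑ xs g
∑-mono []       le = z≤n
∑-mono (x ∷ xs) le = +-mono-≤ (le x) (∑-mono xs le)

∑-+ : ∀ (xs : List A) (f g : A → ℕ) → ∑ xs (λ x → f x + g x) ≡ ∑ xs f + ∑ xs g
∑-+ []       f g = refl
∑-+ (x ∷ xs) f g = trans (cong (f x + g x +_) (∑-+ xs f g)) (interchange (f x) (g x) (∑ xs f) (∑ xs g))
  where
  interchange : ∀ a b c d → a + b + (c + d) ≡ a + c + (b + d)
  interchange = solve-∀

∑-*ˡ : ∀ (xs : List A) c (f : A → ℕ) → c * ∑ xs f ≡ ∑ xs (λ x → c * f x)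
∑-*ˡ []       c f = *-zeroʳ c
∑-*ˡ (x ∷ xs) c f = trans (*-distribˡ-+ c (f x) (∑ xs f)) (cong (c * f x +_) (∑-*ˡ xs c f))

∑-*ʳ : ∀ (xs : List A) c (f : A → ℕ) → ∑ xs f * c ≡ ∑ xs (λ x → f x * c)
∑-*ʳ []       c f = refl
∑-*ʳ (x ∷ xs) c f = trans (*-distribʳ-+ c (f x) (∑ xs f)) (cong (f x * c +_) (∑-*ʳ xs c f))

*-interchange : ∀ a b c d → a * b * (c * d) ≡ a * c * (b * d)
*-interchange = solve-∀

xy*z≡y*xz : ∀ x y z → x * y * z ≡ y * (x * z)
xy*z≡y*xz = solve-∀

x*yz≡y*xz : ∀ x y z → x * (y * z) ≡ y * (x * z)
x*yz≡y*xz = solve-∀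

∑-*-interchange : ∀ (xs : List A) a b (f g : A → ℕ) →
  a * b * ∑ xs (λ x → f x * g x) ≡ ∑ xs (λ x → a * f x * (b * g x))
∑-*-interchange xs a b f g = trans (∑-*ˡ xs (a * b) _) (∑-cong xs (λ x → *-interchange a b (f x) (g x)))

∑-const : ∀ (xs : List A) c → ∑ xs (λ _ → c) ≡ length xs * c
∑-const []       c = refl
∑-const (x ∷ xs) c = cong (c +_) (∑-const xs c)

∑-zero : ∀ (xs : List A) → ∑ xs (λ _ → 0) ≡ 0
∑-zero xs = trans (∑-const xs 0) (*-zeroʳ (length xs))

∑-swap : ∀ (xs : List A) (ys : List B) (f : A → B → ℕ) →
  ∑ xs (λ x → ∑ ys (f x)) ≡ ∑ ys (λ y → ∑ xs (λ x → f x y))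
∑-swap []       ys f = sym (∑-zero ys)
∑-swap (x ∷ xs) ys f = trans (cong (∑ ys (f x) +_) (∑-swap xs ys f)) (sym (∑-+ ys (f x) _))

∑-++ : ∀ (xs ys : List A) (f : A → ℕ) → ∑ (xs ++ ys) f ≡ ∑ xs f + ∑ ys f
∑-++ []       ys f = refl
∑-++ (x ∷ xs) ys f = trans (cong (f x +_) (∑-++ xs ys f)) (sym (+-assoc (f x) _ _))

∑-map : ∀ (g : A → B) (xs : List A) (f : B → ℕ) → ∑ (map g xs) f ≡ ∑ xs (λ x → f (g x))
∑-map g []       f = refl
∑-map g (x ∷ xs) f = cong (f (g x) +_) (∑-map g xs f)

∑-product : ∀ (g : A → B → C) (xs : List A) (ys : List B) (f : C → ℕ) →
  ∑ (cartesianProductWith g xs ys) f ≡ ∑ xs (λ x → ∑ ys (λ y → f (g x y)))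
∑-product g []       ys f = refl
∑-product g (x ∷ xs) ys f = trans (∑-++ (map (g x) ys) _ f)
  (cong₂ _+_ (∑-map (g x) ys f) (∑-product g xs ys f))

∑-tabulate : ∀ {n} (g : Fin n → A) (f : A → ℕ) → ∑ (tabulate g) f ≡ ∑ (allFin n) (λ i → f (g i))
∑-tabulate {n = zero}  g f = refl
∑-tabulate {n = suc n} g f = cong (f (g zero) +_)
  (trans (∑-tabulate (λ i → g (suc i)) f) (sym (∑-tabulate suc (λ i → f (g i)))))

∑-allFin-suc : ∀ {n} (f : Fin (suc n) → ℕ) → ∑ (allFin (suc n)) f ≡ f zero + ∑ (allFin n) (λ i → f (suc i))
∑-allFin-suc f = cong (f zero +_) (∑-tabulate suc f)

∑-lookup : ∀ (xs : List A) (f : A → ℕ) → ∑ (allFin (length xs)) (λ i → f (lookup xs i)) ≡ ∑ xs f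
∑-lookup []       f = refl
∑-lookup (x ∷ xs) f = trans (∑-allFin-suc (λ i → f (lookup (x ∷ xs) i))) (cong (f x +_) (∑-lookup xs f))

term≤∑ : ∀ {x : A} {xs} (f : A → ℕ) → x ∈ xs → f x ≤ ∑ xs f
term≤∑ f (here refl) = m≤m+n (f _) _
term≤∑ f (there x∈xs) = ≤-trans (term≤∑ f x∈xs) (m≤n+m _ _)

-- Powers, squares and the Cauchy-Schwarz inequality

^-distribʳ-* : ∀ m n o → (m * n) ^ o ≡ m ^ o * n ^ o
^-distribʳ-* m n zero    = refl
^-distribʳ-* m n (suc o) = trans (cong (m * n *_) (^-distribʳ-* m n o)) (*-interchange m n (m ^ o) (n ^ o))

^-cancelˡ-≤ : ∀ o .{{_ : NonZero o}} {m n} → m ^ o ≤ n ^ o → m ≤ n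
^-cancelˡ-≤ o le = ≮⇒≥ (λ n<m → <⇒≱ (^-monoˡ-< o n<m) le)

m^2≡m*m : ∀ m → m ^ 2 ≡ m * m
m^2≡m*m m = cong (m *_) (*-identityʳ m)

square-cancel-≤ : ∀ {m n} → m * m ≤ n * n → m ≤ n
square-cancel-≤ {m} {n} le = ^-cancelˡ-≤ 2 (subst₂ _≤_ (sym (m^2≡m*m m)) (sym (m^2≡m*m n)) le)

-- Raising both arguments by one adds `4 * (x + y + 1)` to either side, so the induction runs down
-- to a zero argument and avoids subtraction.
am-gm : ∀ x y → 4 * (x * y) ≤ (x + y) * (x + y)
am-gm zero    y       = z≤n
am-gm (suc x) zero    rewrite *-zeroʳ x = z≤n
am-gm (suc x) (suc y) = subst₂ _≤_ (lhs x y) (rhs x y) (+-monoˡ-≤ (4 * (x + y + 1)) (am-gm x y))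
  where
  lhs : ∀ x y → 4 * (x * y) + 4 * (x + y + 1) ≡ 4 * (suc x * suc y)
  lhs = solve-∀
  rhs : ∀ x y → (x + y) * (x + y) + 4 * (x + y + 1) ≡ (suc x + suc y) * (suc x + suc y)
  rhs = solve-∀

cauchy-schwarz : ∀ (xs : List A) (f g : A → ℕ) →
  ∑ xs (λ x → f x * g x) * ∑ xs (λ x → f x * g x) ≤ ∑ xs (λ x → f x * f x) * ∑ xs (λ x → g x * g x)
cauchy-schwarz []       f g = z≤n
cauchy-schwarz (x ∷ xs) f g = begin
  (a * b + S) * (a * b + S)                                   ≡⟨ expand a b S ⟩
  a * a * (b * b) + (S * S) + 2 * (a * b * S)         ≤⟨ +-mono-≤ (+-monoʳ-≤ (a * a * (b * b)) ih) cross ⟩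
  a * a * (b * b) + P * Q + (a * a * Q + b * b * P) ≡⟨ collect a b P Q ⟩
  (a * a + P) * (b * b + Q)                         ∎
  where
  open ≤-Reasoning
  a = f x
  b = g x
  S = ∑ xs (λ x → f x * g x)
  P = ∑ xs (λ x → f x * f x)
  Q = ∑ xs (λ x → g x * g x)
  ih : (S * S) ≤ P * Q
  ih = cauchy-schwarz xs f g
  expand : ∀ a b S → (a * b + S) * (a * b + S) ≡ a * a * (b * b) + (S * S) + 2 * (a * b * S)
  expand = solve-∀
  collect : ∀ a b P Q → a * a * (b * b) + P * Q + (a * a * Q + b * b * P) ≡ (a * a + P) * (b * b + Q)
  collect = solve-∀
  squared : ∀ a b S → 2 * (a * b * S) * (2 * (a * b * S)) ≡ 4 * (a * a * (b * b)) * (S * S)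
  squared = solve-∀
  regroup : ∀ a b P Q → 4 * (a * a * (b * b)) * (P * Q) ≡ 4 * (a * a * Q * (b * b * P))
  regroup = solve-∀
  cross : 2 * (a * b * S) ≤ a * a * Q + b * b * P
  -- The cross term is compared through squares: the induction hypothesis replaces `S * S` by
  -- `P * Q`, and `am-gm` is applied to `a * a * Q` and `b * b * P`.
  cross = square-cancel-≤ (begin
    2 * (a * b * S) * (2 * (a * b * S))               ≡⟨ squared a b S ⟩
    4 * (a * a * (b * b)) * (S * S)       ≤⟨ *-monoʳ-≤ (4 * (a * a * (b * b))) ih ⟩
    4 * (a * a * (b * b)) * (P * Q)     ≡⟨ regroup a b P Q ⟩
    4 * (a * a * Q * (b * b * P))       ≤⟨ am-gm (a * a * Q) (b * b * P) ⟩
    (a * a * Q + b * b * P) * (a * a * Q + b * b * P)         ∎)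

-- Log-convex sequences

module _ (f : ℕ → ℕ) (convex : ∀ a → f (suc a) * f (suc a) ≤ f a * f (suc (suc a))) where
  open ≤-Reasoning

  -- Convexity of log f at the point `n` between `0` and `n + 1`. In the induction, the local
  -- inequality is raised to the power `n + 1`, the hypothesis is inserted, and the common factor
  -- `f (n + 1) ^ n` is cancelled.
  logconvex-last : ∀ n → f n ^ suc n ≤ f 0 * f (suc n) ^ n
  logconvex-last zero    = ≤-refl
  logconvex-last (suc n) with f (suc n) in eq
  -- The cancellation divides by a power of `f (suc n)`; when that value is zero the left side
  -- vanishes.
  ... | zero  = z≤n
  ... | suc z = *-cancelˡ-≤ (y ^ n) {{m^n≢0 y n}} (begin
    y ^ n * y ^ suc (suc n)                   ≡⟨ sym (^-distribˡ-+-* y n (suc (suc n))) ⟩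
    y ^ (n + suc (suc n))                     ≡⟨ cong (y ^_) (double n) ⟩
    y ^ (2 * suc n)                           ≡⟨ sym (^-*-assoc y 2 (suc n)) ⟩
    (y ^ 2) ^ suc n                           ≤⟨ ^-monoˡ-≤ (suc n) (subst (_≤ f n * x) (sym (m^2≡m*m y)) (subst (λ t → t * t ≤ f n * x) eq (convex n))) ⟩
    (f n * x) ^ suc n                         ≡⟨ ^-distribʳ-* (f n) x (suc n) ⟩
    f n ^ suc n * x ^ suc n                   ≤⟨ *-monoˡ-≤ (x ^ suc n) (subst (λ t → f n ^ suc n ≤ f 0 * t ^ n) eq (logconvex-last n)) ⟩
    f 0 * y ^ n * x ^ suc n                   ≡⟨ xy*z≡y*xz (f 0) (y ^ n) (x ^ suc n) ⟩
    y ^ n * (f 0 * x ^ suc n)                 ∎)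
    where
    y = suc z
    x = f (suc (suc n))
    double : ∀ n → n + suc (suc n) ≡ 2 * suc n
    double = solve-∀

  -- The right endpoint moves from `n = a + b` to `n + 1` by `logconvex-last`. Instead of extracting
  -- roots, the `n`-th power of the inequality is proved and cancelled; the case `a = 0` is split
  -- off so that `n` is positive.
  logconvex : ∀ a b → f a ^ (a + b) ≤ f 0 ^ b * f (a + b) ^ a
  logconvex zero    b = ≤-reflexive (sym (*-identityʳ _))
  logconvex (suc a) zero rewrite +-identityʳ a = ≤-reflexive (sym (*-identityˡ _))
  logconvex (suc c) (suc b) rewrite +-suc c b = ^-cancelˡ-≤ n (begin
    (f a ^ suc n) ^ n                                   ≡⟨ ^-swap (f a) (suc n) n ⟩
    (f a ^ n) ^ suc n                                   ≤⟨ ^-monoˡ-≤ (suc n) (logconvex a b) ⟩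
    (f 0 ^ b * f n ^ a) ^ suc n                         ≡⟨ ^-distribʳ-* (f 0 ^ b) (f n ^ a) (suc n) ⟩
    (f 0 ^ b) ^ suc n * (f n ^ a) ^ suc n               ≡⟨ cong ((f 0 ^ b) ^ suc n *_) (^-swap (f n) a (suc n)) ⟩
    (f 0 ^ b) ^ suc n * (f n ^ suc n) ^ a               ≤⟨ *-monoʳ-≤ ((f 0 ^ b) ^ suc n) (^-monoˡ-≤ a (logconvex-last n)) ⟩
    (f 0 ^ b) ^ suc n * (f 0 * f (suc n) ^ n) ^ a       ≡⟨ cong ((f 0 ^ b) ^ suc n *_) (^-distribʳ-* (f 0) (f (suc n) ^ n) a) ⟩
    (f 0 ^ b) ^ suc n * (f 0 ^ a * (f (suc n) ^ n) ^ a) ≡⟨ sym (*-assoc ((f 0 ^ b) ^ suc n) (f 0 ^ a) _) ⟩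
    (f 0 ^ b) ^ suc n * f 0 ^ a * (f (suc n) ^ n) ^ a   ≡⟨ cong₂ _*_ collect (^-swap (f (suc n)) n a) ⟩
    (f 0 ^ suc b) ^ n * (f (suc n) ^ a) ^ n             ≡⟨ sym (^-distribʳ-* (f 0 ^ suc b) (f (suc n) ^ a) n) ⟩
    (f 0 ^ suc b * f (suc n) ^ a) ^ n                   ∎)
    where
    a = suc c
    n = a + b
    ^-swap : ∀ m i j → (m ^ i) ^ j ≡ (m ^ j) ^ i
    ^-swap m i j = trans (^-*-assoc m i j) (trans (cong (m ^_) (*-comm i j)) (sym (^-*-assoc m j i)))
    exponents : ∀ a b → b * suc (a + b) + a ≡ suc b * (a + b)
    exponents = solve-∀
    collect : (f 0 ^ b) ^ suc n * f 0 ^ a ≡ (f 0 ^ suc b) ^ n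
    collect = trans (cong (_* f 0 ^ a) (^-*-assoc (f 0) b (suc n)))
      (trans (sym (^-distribˡ-+-* (f 0) (b * suc n) a))
      (trans (cong (f 0 ^_) (exponents a b)) (sym (^-*-assoc (f 0) (suc b) n))))

-- Matrices

Matrix : Set → Set → Set
Matrix A B = A → B → ℕ

transpose : Matrix A B → Matrix B A
transpose P x y = P y x

mul : List B → Matrix A B → Matrix B C → Matrix A C
mul L P Q x z = ∑ L (λ y → P x y * Q y z)

-- pow L m P is the power P ^ (m + 1).
pow : List A → ℕ → Matrix A A → Matrix A A
pow L zero    P = P
pow L (suc m) P = mul L P (pow L m P)

tr : List A → Matrix A A → ℕ
tr L P = ∑ L (λ x → P x x)

mul-congʳ : ∀ (L : List B) (P : Matrix A B) {Q Q′ : Matrix B C} → (∀ x y → Q x y ≡ Q′ x y) →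
  ∀ x z → mul L P Q x z ≡ mul L P Q′ x z
mul-congʳ L P eq x z = ∑-cong L (λ y → cong (P x y *_) (eq y z))

mul-assoc : ∀ (K : List B) (L : List C) (P : Matrix A B) (Q : Matrix B C) (R : Matrix C D) →
  ∀ x w → mul L (mul K P Q) R x w ≡ mul K P (mul L Q R) x w
mul-assoc K L P Q R x w = begin
  ∑ L (λ z → ∑ K (λ y → P x y * Q y z) * R z w)   ≡⟨ ∑-cong L (λ z → ∑-*ʳ K (R z w) _) ⟩
  ∑ L (λ z → ∑ K (λ y → P x y * Q y z * R z w))   ≡⟨ ∑-swap L K _ ⟩
  ∑ K (λ y → ∑ L (λ z → P x y * Q y z * R z w))   ≡⟨ ∑-cong K (λ y → trans (∑-cong L (λ z → *-assoc (P x y) (Q y z) (R z w))) (sym (∑-*ˡ L (P x y) _))) ⟩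
  ∑ K (λ y → P x y * ∑ L (λ z → Q y z * R z w))   ∎
  where open ≡-Reasoning

tr-cong : ∀ (L : List A) {P Q : Matrix A A} → (∀ x y → P x y ≡ Q x y) → tr L P ≡ tr L Q
tr-cong L eq = ∑-cong L (λ x → eq x x)

tr-mul-comm : ∀ (K : List A) (L : List B) (P : Matrix A B) (Q : Matrix B A) →
  tr K (mul L P Q) ≡ tr L (mul K Q P)
tr-mul-comm K L P Q = trans (∑-swap K L _) (∑-cong L (λ y → ∑-cong K (λ x → *-comm (P x y) (Q y x))))

-- Index `m` stands for exponent `m + 1`, so adding exponents adds one to the sum of the indices.
mul-pow : ∀ (L : List A) (P : Matrix A A) i j → ∀ x y →
  mul L (pow L i P) (pow L j P) x y ≡ pow L (suc (i + j)) P x y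
mul-pow L P zero    j x y = refl
mul-pow L P (suc i) j x y = trans (mul-assoc L L P (pow L i P) (pow L j P) x y)
  (mul-congʳ L P (mul-pow L P i j) x y)

-- Entries are natural numbers, so an entrywise bound survives multiplication. The factors `c` and
-- `c′` stand for a rational constant with denominators cleared.
pow-mono : ∀ (L : List A) {P Q : Matrix A A} c c′ → (∀ x y → c * P x y ≤ c′ * Q x y) →
  ∀ m x y → c ^ suc m * pow L m P x y ≤ c′ ^ suc m * pow L m Q x y
pow-mono L {P} {Q} c c′ le zero x y rewrite *-identityʳ c | *-identityʳ c′ = le x y
pow-mono L {P} {Q} c c′ le (suc m) x y = begin
  c * c ^ suc m * ∑ L (λ z → P x z * pow L m P z y)        ≡⟨ ∑-*-interchange L c (c ^ suc m) (P x) (λ z → pow L m P z y) ⟩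
  ∑ L (λ z → c * P x z * (c ^ suc m * pow L m P z y))      ≤⟨ ∑-mono L (λ z → *-mono-≤ (le x z) (pow-mono L c c′ le m z y)) ⟩
  ∑ L (λ z → c′ * Q x z * (c′ ^ suc m * pow L m Q z y))    ≡⟨ sym (∑-*-interchange L c′ (c′ ^ suc m) (Q x) (λ z → pow L m Q z y)) ⟩
  c′ * c′ ^ suc m * ∑ L (λ z → Q x z * pow L m Q z y)      ∎
  where
  open ≤-Reasoning

-- Regrouping gives (PQ)^(m+2) = P (QP)^(m+1) Q, the form in which the trace can be cycled.
pow-factor : ∀ (K : List A) (L : List B) (P : Matrix A B) (Q : Matrix B A) m → ∀ x y →
  pow K (suc m) (mul L P Q) x y ≡ mul L P (mul L (pow L m (mul K Q P)) Q) x y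
pow-factor K L P Q zero x y =
  trans (mul-assoc L K P Q (mul L P Q) x y)
    (mul-congʳ L P (λ z w → sym (mul-assoc K L Q P Q z w)) x y)
pow-factor K L P Q (suc m) x y = begin
  mul K (mul L P Q) (pow K (suc m) (mul L P Q)) x y        ≡⟨ mul-congʳ K (mul L P Q) (pow-factor K L P Q m) x y ⟩
  mul K (mul L P Q) (mul L P (mul L X Q)) x y              ≡⟨ mul-assoc L K P Q (mul L P (mul L X Q)) x y ⟩
  mul L P (mul K Q (mul L P (mul L X Q))) x y              ≡⟨ mul-congʳ L P (λ z w → sym (mul-assoc K L Q P (mul L X Q) z w)) x y ⟩
  mul L P (mul L (mul K Q P) (mul L X Q)) x y              ≡⟨ mul-congʳ L P (λ z w → sym (mul-assoc L L (mul K Q P) X Q z w)) x y ⟩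
  mul L P (mul L (mul L (mul K Q P) X) Q) x y              ∎
  where
  open ≡-Reasoning
  X = pow L m (mul K Q P)

-- Lets a trace over vertices be computed over incidence classes, where the matrix is bounded by a
-- multiple of M I + J.
tr-pow-mul-comm : ∀ (K : List A) (L : List B) (P : Matrix A B) (Q : Matrix B A) m →
  tr K (pow K m (mul L P Q)) ≡ tr L (pow L m (mul K Q P))
tr-pow-mul-comm K L P Q zero    = tr-mul-comm K L P Q
tr-pow-mul-comm K L P Q (suc m) = begin
  tr K (pow K (suc m) (mul L P Q))         ≡⟨ tr-cong K (pow-factor K L P Q m) ⟩
  tr K (mul L P (mul L X Q))               ≡⟨ tr-mul-comm K L P (mul L X Q) ⟩
  tr L (mul K (mul L X Q) P)               ≡⟨ tr-cong L (mul-assoc L K X Q P) ⟩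
  tr L (mul L X (mul K Q P))               ≡⟨ tr-mul-comm L L X (mul K Q P) ⟩
  tr L (pow L (suc m) (mul K Q P))         ∎
  where
  open ≡-Reasoning
  X = pow L m (mul K Q P)

-- Graphs live on `Fin (length L)`; this passes to matrices indexed by the labels listed in `L`.
pow-lookup : ∀ (L : List A) (P : Matrix A A) m i j →
  pow (allFin (length L)) m (λ a b → P (lookup L a) (lookup L b)) i j ≡ pow L m P (lookup L i) (lookup L j)
pow-lookup L P zero    i j = refl
pow-lookup L P (suc m) i j =
  trans (∑-cong (allFin (length L)) (λ k → cong (P (lookup L i) (lookup L k) *_) (pow-lookup L P m k j)))
    (∑-lookup L (λ z → P (lookup L i) z * pow L m P z (lookup L j)))

tr-pow-lookup : ∀ (L : List A) (P : Matrix A A) m →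
  tr (allFin (length L)) (pow (allFin (length L)) m (λ a b → P (lookup L a) (lookup L b))) ≡ tr L (pow L m P)
tr-pow-lookup L P m = trans (∑-cong (allFin (length L)) (λ i → pow-lookup L P m i i))
  (∑-lookup L (λ z → pow L m P z z))

-- Closed walks of a symmetric matrix

parity : ∀ n → ∃ λ a → n ≡ a + a ⊎ n ≡ suc (a + a)
parity zero = 0 , inj₁ refl
parity (suc n) with parity n
... | a , inj₁ eq = a , inj₂ (cong suc eq)
... | a , inj₂ eq = suc a , inj₁ (cong suc (trans eq (sym (+-suc a a))))

halve-≤ : ∀ {a b} → a + a ≤ b + b → a ≤ b
halve-≤ le = ≮⇒≥ (λ b<a → <⇒≱ (+-mono-< b<a b<a) le)

square-^ : ∀ m n → (m * m) ^ n ≡ m ^ (n + n)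
square-^ m n = trans (^-distribʳ-* m m n) (sym (^-distribˡ-+-* m n n))

cauchy-schwarz₂ : ∀ (xs : List A) (ys : List B) (f g : A → B → ℕ) →
  let S = ∑ xs (λ x → ∑ ys (λ y → f x y * g x y)) in
  S * S ≤ ∑ xs (λ x → ∑ ys (λ y → f x y * f x y)) * ∑ xs (λ x → ∑ ys (λ y → g x y * g x y))
cauchy-schwarz₂ xs ys f g = subst₂ _≤_
  (cong₂ _*_ (∑-product _,_ xs ys (λ (x , y) → f x y * g x y)) (∑-product _,_ xs ys (λ (x , y) → f x y * g x y)))
  (cong₂ _*_ (∑-product _,_ xs ys (λ (x , y) → f x y * f x y)) (∑-product _,_ xs ys (λ (x , y) → g x y * g x y)))
  (cauchy-schwarz (cartesianProduct xs ys) (λ (x , y) → f x y) (λ (x , y) → g x y))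

module SymmetricMatrix (L : List A) (P : Matrix A A) (P-sym : ∀ x y → P x y ≡ P y x) where
  open ≤-Reasoning

  pow-sym : ∀ m x y → pow L m P x y ≡ pow L m P y x
  pow-sym zero    x y = P-sym x y
  pow-sym (suc m) x y = trans
    (∑-cong L (λ z → trans (*-comm (P x z) _) (cong₂ _*_ (pow-sym m z y) (P-sym x z))))
    (trans (mul-pow L P m 0 y x) (cong (λ t → pow L (suc t) P y x) (+-identityʳ m)))

  -- moment e is the trace of P ^ (e + 2).
  moment : ℕ → ℕ
  moment e = tr L (pow L (suc e) P)

  -- By symmetry the trace of a product of two powers is their entrywise inner product, to which
  -- Cauchy-Schwarz applies.
  moment-inner : ∀ i j → moment (i + j) ≡ ∑ L (λ x → ∑ L (λ y → pow L i P x y * pow L j P x y))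
  moment-inner i j = trans (tr-cong L (λ x y → sym (mul-pow L P i j x y)))
    (∑-cong L (λ x → ∑-cong L (λ y → cong (pow L i P x y *_) (pow-sym j y x))))

  moment-cauchy-schwarz : ∀ i j → moment (i + j) * moment (i + j) ≤ moment (i + i) * moment (j + j)
  moment-cauchy-schwarz i j rewrite moment-inner i j | moment-inner i i | moment-inner j j =
    cauchy-schwarz₂ L L (pow L i P) (pow L j P)

  -- The bounds supplied by Cauchy-Schwarz are moments of even index, so the log-convex sequence
  -- sends `a` to `moment (a + a)`.
  moment-logconvex : ∀ a b → moment (a + a) ^ (a + b) ≤ moment 0 ^ b * moment ((a + b) + (a + b)) ^ a
  moment-logconvex = logconvex (λ a → moment (a + a)) (λ a →
    subst (λ t → moment t * moment t ≤ moment (a + a) * moment (suc (suc a) + suc (suc a)))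
      (+-suc a (suc a)) (moment-cauchy-schwarz a (suc (suc a))))

  moment-even : ∀ a b → let K = a + b in
    moment (a + a) ^ (K + K) ≤ moment 0 ^ (b + b) * moment (K + K) ^ (a + a)
  moment-even a b = begin
    moment (a + a) ^ (K + K)                          ≡⟨ ^-distribˡ-+-* (moment (a + a)) K K ⟩
    moment (a + a) ^ K * moment (a + a) ^ K           ≤⟨ *-mono-≤ (moment-logconvex a b) (moment-logconvex a b) ⟩
    X ^ b * Y ^ a * (X ^ b * Y ^ a)                   ≡⟨ *-interchange (X ^ b) (Y ^ a) (X ^ b) (Y ^ a) ⟩
    X ^ b * X ^ b * (Y ^ a * Y ^ a)                   ≡⟨ sym (cong₂ _*_ (^-distribˡ-+-* X b b) (^-distribˡ-+-* Y a a)) ⟩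
    X ^ (b + b) * Y ^ (a + a)                         ∎
    where
    K = a + b
    X = moment 0
    Y = moment (K + K)

  -- An odd index lies midway between two even ones. Cauchy-Schwarz bounds the square of its moment
  -- by the product of the neighbours, and each neighbour is interpolated between `moment 0` and
  -- `moment (K + K)`.
  moment-odd : ∀ a b → let K = suc a + b in
    moment (suc (a + a)) ^ (K + K) ≤ moment 0 ^ suc (b + b) * moment (K + K) ^ suc (a + a)
  moment-odd a b = begin
    s ^ (K + K)                                       ≡⟨ sym (square-^ s K) ⟩
    (s * s) ^ K                                       ≤⟨ ^-monoˡ-≤ K (subst (λ t → moment t * moment t ≤ u * v) (+-suc a a) (moment-cauchy-schwarz a (suc a))) ⟩
    (u * v) ^ K                                       ≡⟨ ^-distribʳ-* u v K ⟩
    u ^ K * v ^ K                                     ≤⟨ *-mono-≤ left (moment-logconvex (suc a) b) ⟩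
    X ^ suc b * Y ^ a * (X ^ b * Y ^ suc a)           ≡⟨ *-interchange (X ^ suc b) (Y ^ a) (X ^ b) (Y ^ suc a) ⟩
    X ^ suc b * X ^ b * (Y ^ a * Y ^ suc a)           ≡⟨ sym (cong₂ _*_ (^-distribˡ-+-* X (suc b) b) (^-distribˡ-+-* Y a (suc a))) ⟩
    X ^ suc (b + b) * Y ^ (a + suc a)                 ≡⟨ cong (λ t → X ^ suc (b + b) * Y ^ t) (+-suc a a) ⟩
    X ^ suc (b + b) * Y ^ suc (a + a)                 ∎
    where
    K = suc a + b
    X = moment 0
    Y = moment (K + K)
    s = moment (suc (a + a))
    u = moment (a + a)
    v = moment (suc a + suc a)
    left : u ^ K ≤ X ^ suc b * Y ^ a
    left = subst (λ t → u ^ t ≤ X ^ suc b * moment (t + t) ^ a) (+-suc a b) (moment-logconvex a (suc b))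

  -- With `e = ℓ - 2`, `g = 2k - ℓ` and `K = k - 1`, this interpolates tr P^ℓ between tr P^2 and tr
  -- P^(2k). The parity of `e` selects the even or the odd case.
  moment-interpolate : ∀ e g K → e + g ≡ K + K →
    moment e ^ (K + K) ≤ moment 0 ^ g * moment (K + K) ^ e
  moment-interpolate e g K eq with parity e
  ... | a , inj₁ refl = subst₂ (λ t h → moment (a + a) ^ (t + t) ≤ moment 0 ^ h * moment (t + t) ^ (a + a))
    a+b≡K b+b≡g (moment-even a b)
    where
    b = K ∸ a
    a+b≡K : a + b ≡ K
    a+b≡K = m+[n∸m]≡n (halve-≤ {a} {K} (subst (a + a ≤_) eq (m≤m+n (a + a) g)))
    regroup : ∀ a b → a + a + (b + b) ≡ a + b + (a + b)
    regroup = solve-∀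
    b+b≡g : b + b ≡ g
    b+b≡g = +-cancelˡ-≡ (a + a) (b + b) g (trans (regroup a b) (trans (cong₂ _+_ a+b≡K a+b≡K) (sym eq)))
  ... | a , inj₂ refl = subst₂ (λ t h → moment (suc (a + a)) ^ (t + t) ≤ moment 0 ^ h * moment (t + t) ^ suc (a + a))
    a+b≡K b+b≡g (moment-odd a b)
    where
    b = K ∸ suc a
    a<K : a < K
    a<K = ≰⇒> (λ K≤a → <⇒≱ (s≤s (+-mono-≤ K≤a K≤a)) (subst (suc (a + a) ≤_) eq (m≤m+n (suc (a + a)) g)))
    a+b≡K : suc a + b ≡ K
    a+b≡K = m+[n∸m]≡n a<K
    regroup : ∀ a b → suc (a + a) + suc (b + b) ≡ suc a + b + (suc a + b)
    regroup = solve-∀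
    b+b≡g : suc (b + b) ≡ g
    b+b≡g = +-cancelˡ-≡ (suc (a + a)) (suc (b + b)) g
      (trans (regroup a b) (trans (cong₂ _+_ a+b≡K a+b≡K) (sym eq)))

  -- Counts of walks with free endpoints

  walksFrom : ℕ → A → ℕ
  walksFrom zero    x = 1
  walksFrom (suc m) x = ∑ L (λ y → P x y * walksFrom m y)

  walks : ℕ → ℕ
  walks m = ∑ L (walksFrom m)

  -- Symmetry of `P` moves one factor at a time from the left vector to the right one, so the inner
  -- product depends on `i + j` alone.
  walks-inner : ∀ i j → ∑ L (λ x → walksFrom i x * walksFrom j x) ≡ walks (i + j)
  walks-inner zero    j = ∑-cong L (λ x → *-identityˡ (walksFrom j x))
  walks-inner (suc i) j = begin-equality
    ∑ L (λ x → ∑ L (λ y → P x y * r i y) * r j x)     ≡⟨ ∑-cong L (λ x → ∑-*ʳ L (r j x) _) ⟩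
    ∑ L (λ x → ∑ L (λ y → P x y * r i y * r j x))     ≡⟨ ∑-swap L L _ ⟩
    ∑ L (λ y → ∑ L (λ x → P x y * r i y * r j x))     ≡⟨ ∑-cong L (λ y → ∑-cong L (λ x → trans (cong (λ t → t * r i y * r j x) (P-sym x y)) (xy*z≡y*xz (P y x) (r i y) (r j x)))) ⟩
    ∑ L (λ y → ∑ L (λ x → r i y * (P y x * r j x)))   ≡⟨ ∑-cong L (λ y → sym (∑-*ˡ L (r i y) _)) ⟩
    ∑ L (λ y → r i y * r (suc j) y)                   ≡⟨ walks-inner i (suc j) ⟩
    walks (i + suc j)                                 ≡⟨ cong walks (+-suc i j) ⟩
    walks (suc i + j)                                 ∎
    where
    r = walksFrom

  walks-cauchy-schwarz : ∀ i j → walks (i + j) * walks (i + j) ≤ walks (i + i) * walks (j + j)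
  walks-cauchy-schwarz i j = subst₂ _≤_ (cong₂ _*_ (walks-inner i j) (walks-inner i j))
    (cong₂ _*_ (walks-inner i i) (walks-inner j j)) (cauchy-schwarz L (walksFrom i) (walksFrom j))

  walks-logconvex : ∀ a b → walks (a + a) ^ (a + b) ≤ walks 0 ^ b * walks ((a + b) + (a + b)) ^ a
  walks-logconvex = logconvex (λ a → walks (a + a)) (λ a →
    subst (λ t → walks t * walks t ≤ walks (a + a) * walks (suc (suc a) + suc (suc a)))
      (+-suc a (suc a)) (walks-cauchy-schwarz a (suc (suc a))))

  walksFrom-pow : ∀ m x → walksFrom (suc m) x ≡ ∑ L (pow L m P x)
  walksFrom-pow zero    x = ∑-cong L (λ y → *-identityʳ (P x y))
  walksFrom-pow (suc m) x = begin-equality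
    ∑ L (λ y → P x y * walksFrom (suc m) y)           ≡⟨ ∑-cong L (λ y → trans (cong (P x y *_) (walksFrom-pow m y)) (∑-*ˡ L (P x y) _)) ⟩
    ∑ L (λ y → ∑ L (λ z → P x y * pow L m P y z))     ≡⟨ ∑-swap L L _ ⟩
    ∑ L (λ z → ∑ L (λ y → P x y * pow L m P y z))     ∎

  n = length L

  walks-0 : walks 0 ≡ n
  walks-0 = trans (∑-const L 1) (*-identityʳ n)

  -- Cauchy-Schwarz in each row: the squared row sum of a power of `P` is at most `n` times the sum
  -- of its squared entries, and over all rows these squares add up to a trace.
  walks≤moment : ∀ m → walks (suc m + suc m) ≤ n * moment (m + m)
  walks≤moment m = begin
    walks (suc m + suc m)                                         ≡⟨ sym (walks-inner (suc m) (suc m)) ⟩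
    ∑ L (λ x → walksFrom (suc m) x * walksFrom (suc m) x)         ≤⟨ ∑-mono L pointwise ⟩
    ∑ L (λ x → n * ∑ L (λ y → pow L m P x y * pow L m P x y))     ≡⟨ sym (∑-*ˡ L n _) ⟩
    n * ∑ L (λ x → ∑ L (λ y → pow L m P x y * pow L m P x y))     ≡⟨ cong (n *_) (sym (moment-inner m m)) ⟩
    n * moment (m + m)                                            ∎
    where
    pointwise : ∀ x → walksFrom (suc m) x * walksFrom (suc m) x ≤ n * ∑ L (λ y → pow L m P x y * pow L m P x y)
    pointwise x = subst₂ _≤_
      (cong₂ _*_ w w) (trans (*-comm S (∑ L (λ _ → 1))) (cong (_* S) walks-0))
      (cauchy-schwarz L (pow L m P x) (λ _ → 1))
      where
      S = ∑ L (λ y → pow L m P x y * pow L m P x y)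
      w : ∑ L (λ y → pow L m P x y * 1) ≡ walksFrom (suc m) x
      w = trans (∑-cong L (λ y → *-identityʳ _)) (sym (walksFrom-pow m x))

  module _ (P-idem : ∀ x y → P x y * P x y ≡ P x y) where

    -- `P-idem` forces every entry to be 0 or 1, so squares of entries may be replaced by the
    -- entries.
    moment-0 : moment 0 ≡ walks 1
    moment-0 = trans (moment-inner 0 0)
      (∑-cong L (λ x → ∑-cong L (λ y → trans (P-idem x y) (sym (*-identityʳ (P x y))))))

    -- Sidorenko's inequality for the cycle of length `2k`, where `k = suc K`: walks of length 1 are
    -- compared with walks of length 2, these with walks of length `2k`, and these with closed
    -- walks.
    sidorenko-evenCycle : ∀ K → moment 0 ^ (suc K + suc K) ≤ n ^ (suc K + suc K) * moment (K + K)
    sidorenko-evenCycle K = begin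
      moment 0 ^ (suc K + suc K)                        ≡⟨ cong (_^ (suc K + suc K)) moment-0 ⟩
      walks 1 ^ (suc K + suc K)                         ≡⟨ sym (square-^ (walks 1) (suc K)) ⟩
      (walks 1 * walks 1) ^ suc K                       ≤⟨ ^-monoˡ-≤ (suc K) (subst (λ t → walks 1 * walks 1 ≤ t * walks 2) walks-0 (walks-cauchy-schwarz 0 1)) ⟩
      (n * walks 2) ^ suc K                             ≡⟨ ^-distribʳ-* n (walks 2) (suc K) ⟩
      n ^ suc K * walks 2 ^ suc K                       ≤⟨ *-monoʳ-≤ (n ^ suc K) (walks-logconvex 1 K) ⟩
      n ^ suc K * (walks 0 ^ K * walks (suc K + suc K) ^ 1) ≡⟨ cong₂ (λ s t → n ^ suc K * (s ^ K * t)) walks-0 (*-identityʳ _) ⟩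
      n ^ suc K * (n ^ K * walks (suc K + suc K))       ≤⟨ *-monoʳ-≤ (n ^ suc K) (*-monoʳ-≤ (n ^ K) (walks≤moment K)) ⟩
      n ^ suc K * (n ^ K * (n * moment (K + K)))        ≡⟨ regroup (n ^ suc K) (n ^ K) n (moment (K + K)) ⟩
      n ^ suc K * n ^ suc K * moment (K + K)            ≡⟨ cong (_* moment (K + K)) (sym (^-distribˡ-+-* n (suc K) (suc K))) ⟩
      n ^ (suc K + suc K) * moment (K + K)              ∎
      where
      regroup : ∀ a b c d → a * (b * (c * d)) ≡ a * (c * b) * d
      regroup = solve-∀

    -- Raising the interpolation to the power `k₂ = 2k` makes `moment 0 ^ k₂` appear, which
    -- `sidorenko-evenCycle` then eliminates.
    moment-bound : ∀ e g K → e + g ≡ K + K → let k₂ = suc K + suc K in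
      moment e ^ ((K + K) * k₂) ≤ n ^ (k₂ * g) * moment (K + K) ^ (g + e * k₂)
    moment-bound e g K eq = begin
      moment e ^ ((K + K) * k₂)                         ≡⟨ sym (^-*-assoc (moment e) (K + K) k₂) ⟩
      (moment e ^ (K + K)) ^ k₂                         ≤⟨ ^-monoˡ-≤ k₂ (moment-interpolate e g K eq) ⟩
      (X ^ g * Y ^ e) ^ k₂                              ≡⟨ ^-distribʳ-* (X ^ g) (Y ^ e) k₂ ⟩
      (X ^ g) ^ k₂ * (Y ^ e) ^ k₂                       ≡⟨ cong₂ _*_ (trans (^-*-assoc X g k₂) (trans (cong (X ^_) (*-comm g k₂)) (sym (^-*-assoc X k₂ g)))) (^-*-assoc Y e k₂) ⟩
      (X ^ k₂) ^ g * Y ^ (e * k₂)                       ≤⟨ *-monoˡ-≤ (Y ^ (e * k₂)) (^-monoˡ-≤ g (sidorenko-evenCycle K)) ⟩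
      (n ^ k₂ * Y) ^ g * Y ^ (e * k₂)                   ≡⟨ cong (_* Y ^ (e * k₂)) (^-distribʳ-* (n ^ k₂) Y g) ⟩
      (n ^ k₂) ^ g * Y ^ g * Y ^ (e * k₂)               ≡⟨ *-assoc ((n ^ k₂) ^ g) (Y ^ g) (Y ^ (e * k₂)) ⟩
      (n ^ k₂) ^ g * (Y ^ g * Y ^ (e * k₂))             ≡⟨ cong₂ _*_ (^-*-assoc n k₂ g) (sym (^-distribˡ-+-* Y g (e * k₂))) ⟩
      n ^ (k₂ * g) * Y ^ (g + e * k₂)                   ∎
      where
      k₂ = suc K + suc K
      X = moment 0
      Y = moment (K + K)

-- Homomorphism counts as sums

ind : Bool → ℕ
ind true  = 1
ind false = 0

ind-mono : ∀ {b c} → (b ≡ true → c ≡ true) → ind b ≤ ind c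
ind-mono {false}         imp = z≤n
ind-mono {true}  {true}  imp = ≤-refl
ind-mono {true}  {false} imp = contradiction (imp refl) λ ()

ind-∧ : ∀ b c → ind (b ∧ c) ≡ ind b * ind c
ind-∧ false c = refl
ind-∧ true  c = sym (+-identityʳ (ind c))

ind-idem : ∀ b → ind b * ind b ≡ ind b
ind-idem false = refl
ind-idem true  = refl

∧-true⁻ : ∀ {b c} → b ∧ c ≡ true → b ≡ true × c ≡ true
∧-true⁻ {true} eq = refl , eq

not-∨-true⁺ : ∀ {b c} → (b ≡ true → c ≡ true) → not b ∨ c ≡ true
not-∨-true⁺ {false} imp = refl
not-∨-true⁺ {true}  imp = imp refl

not-∨-true⁻ : ∀ {b c} → not b ∨ c ≡ true → b ≡ true → c ≡ true
not-∨-true⁻ eq refl = eq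

all-tabulate⁺ : ∀ {n} (p : A → Bool) (g : Fin n → A) → (∀ i → p (g i) ≡ true) → all p (tabulate g) ≡ true
all-tabulate⁺ {n = zero}  p g h = refl
all-tabulate⁺ {n = suc n} p g h rewrite h zero = all-tabulate⁺ p (g ∘ suc) (h ∘ suc)

all-tabulate⁻ : ∀ {n} (p : A → Bool) (g : Fin n → A) → all p (tabulate g) ≡ true → ∀ i → p (g i) ≡ true
all-tabulate⁻ {n = suc n} p g eq i with p (g zero) in pg0
all-tabulate⁻ {n = suc n} p g eq zero    | true = pg0
all-tabulate⁻ {n = suc n} p g eq (suc i) | true = all-tabulate⁻ p (g ∘ suc) eq i

module _ {a b : ℕ} (H : Graph a) (G : Graph b) (f : Vec (Fin b) a) where

  isHom⁺ : (∀ i j → adj H i j ≡ true → adj G (Vec.lookup f i) (Vec.lookup f j) ≡ true) → isHom H G f ≡ true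
  isHom⁺ h = all-tabulate⁺ _ (λ i → i) (λ i → all-tabulate⁺ _ (λ j → j) (λ j → not-∨-true⁺ (h i j)))

  isHom⁻ : isHom H G f ≡ true → ∀ i j → adj H i j ≡ true → adj G (Vec.lookup f i) (Vec.lookup f j) ≡ true
  isHom⁻ eq i j = not-∨-true⁻ (all-tabulate⁻ _ (λ j → j) (all-tabulate⁻ _ (λ i → i) eq i) j)

-- Enumerates in the same order as `allMaps`, but over an arbitrary list of values, so that the same
-- sums serve for vertices given by labels.
tuples : ∀ m → List A → List (Vec A m)
tuples zero    L = [] ∷ []
tuples (suc m) L = cartesianProductWith _∷_ L (tuples m L)

concatMap-map : ∀ (f : A → B → C) xs ys → concatMap (λ x → map (f x) ys) xs ≡ cartesianProductWith f xs ys
concatMap-map f []       ys = refl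
concatMap-map f (x ∷ xs) ys = cong (map (f x) ys ++_) (concatMap-map f xs ys)

allMaps≡tuples : ∀ a b → allMaps a b ≡ tuples a (allFin b)
allMaps≡tuples zero    b = refl
allMaps≡tuples (suc a) b = trans (concatMap-map _∷_ (allFin b) (allMaps a b))
  (cong (cartesianProductWith _∷_ (allFin b)) (allMaps≡tuples a b))

length-filterᵇ : ∀ (p : A → Bool) xs → length (filterᵇ p xs) ≡ ∑ xs (ind ∘ p)
length-filterᵇ p []       = refl
length-filterᵇ p (x ∷ xs) with p x
... | true  = cong suc (length-filterᵇ p xs)
... | false = length-filterᵇ p xs

hom-∑ : ∀ {a b} (H : Graph a) (G : Graph b) → hom H G ≡ ∑ (tuples a (allFin b)) (ind ∘ isHom H G)
hom-∑ {a} {b} H G = trans (length-filterᵇ (isHom H G) (allMaps a b))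
  (cong (λ L → ∑ L (ind ∘ isHom H G)) (allMaps≡tuples a b))

-- Cycles and traces

module _ (R : A → A → Bool) where

  chain : ∀ {m} → A → A → Vec A m → Bool
  chain x y []      = R x y
  chain x y (z ∷ v) = R x z ∧ chain z y v

  chain⁺ : ∀ {m} x y (v : Vec A m) →
    (∀ i → R (Vec.lookup (x ∷ v) i) (Vec.lookup (v ∷ʳ y) i) ≡ true) → chain x y v ≡ true
  chain⁺ x y []      h = h zero
  chain⁺ x y (z ∷ v) h rewrite h zero = chain⁺ z y v (h ∘ suc)

  chain⁻ : ∀ {m} x y (v : Vec A m) → chain x y v ≡ true →
    ∀ i → R (Vec.lookup (x ∷ v) i) (Vec.lookup (v ∷ʳ y) i) ≡ true
  chain⁻ x y []      eq zero = eq
  chain⁻ x y (z ∷ v) eq i with ∧-true⁻ {R x z} eq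
  chain⁻ x y (z ∷ v) eq zero    | h , t = h
  chain⁻ x y (z ∷ v) eq (suc i) | h , t = chain⁻ z y v t i

  -- A walk with `m` interior vertices has `m + 1` steps, which is the exponent behind `pow L m`.
  ∑-chain : ∀ (L : List A) m x y → ∑ (tuples m L) (ind ∘ chain x y) ≡ pow L m (λ x y → ind (R x y)) x y
  ∑-chain L zero    x y = +-identityʳ (ind (R x y))
  ∑-chain L (suc m) x y = trans (∑-product _∷_ L (tuples m L) (ind ∘ chain x y))
    (∑-cong L (λ z → trans (∑-cong (tuples m L) (λ v → ind-∧ (R x z) (chain z y v)))
      (trans (sym (∑-*ˡ (tuples m L) (ind (R x z)) _)) (cong (ind (R x z) *_) (∑-chain L m z y)))))

lookup-∷ʳ-last : ∀ {m} (v : Vec A m) y i → toℕ i ≡ m → Vec.lookup (v ∷ʳ y) i ≡ y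
lookup-∷ʳ-last []      y zero    eq = refl
lookup-∷ʳ-last (x ∷ v) y (suc i) eq = lookup-∷ʳ-last v y i (suc-injective eq)

lookup-∷ʳ-init : ∀ {m} (v : Vec A m) x y i j → toℕ j ≡ suc (toℕ i) → Vec.lookup (v ∷ʳ y) i ≡ Vec.lookup (x ∷ v) j
lookup-∷ʳ-init (z ∷ v) x y zero    (suc zero)    eq = refl
lookup-∷ʳ-init (z ∷ v) x y (suc i) (suc j)       eq = lookup-∷ʳ-init v z y i j (suc-injective eq)

-- Succession modulo `suc m` rotates a closed walk: an index that is not the last moves on inside
-- `v`, and the last one wraps around to the initial vertex.
lookup-rotate : ∀ {m} (v : Vec A m) x i j → suc (toℕ i) % suc m ≡ toℕ j →
  Vec.lookup (v ∷ʳ x) i ≡ Vec.lookup (x ∷ v) j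
lookup-rotate {m = m} v x i j eq with m≤n⇒m<n∨m≡n (toℕ<n i)
... | inj₁ i<m = lookup-∷ʳ-init v x x i j (trans (sym eq) (m<n⇒m%n≡m i<m))
... | inj₂ i≡m = trans (lookup-∷ʳ-last v x i (suc-injective i≡m)) (cong (Vec.lookup (x ∷ v)) (sym j≡0))
  where
  j≡0 : j ≡ zero
  j≡0 = toℕ-injective (trans (sym eq) (trans (cong (_% suc m) i≡m) (n%n≡0 (suc m))))

≡ᵇ-true⁺ : ∀ {m n} → m ≡ n → (m ≡ᵇ n) ≡ true
≡ᵇ-true⁺ {m} {n} eq = Equivalence.to T-≡ (≡⇒≡ᵇ m n eq)

≡ᵇ-true⁻ : ∀ {m n} → (m ≡ᵇ n) ≡ true → m ≡ n
≡ᵇ-true⁻ {m} {n} eq = ≡ᵇ⇒≡ m n (Equivalence.from T-≡ eq)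

∨-trueˡ : ∀ {b c} → b ≡ true → b ∨ c ≡ true
∨-trueˡ refl = refl

∨-true⁻ : ∀ {b c} → b ∨ c ≡ true → b ≡ true ⊎ c ≡ true
∨-true⁻ {true}  eq = inj₁ refl
∨-true⁻ {false} eq = inj₂ eq

adjacency : ∀ {n} → Graph n → Matrix (Fin n) (Fin n)
adjacency G i j = ind (adj G i j)

module _ {n : ℕ} (G : Graph n) (G-sym : ∀ i j → adj G i j ≡ adj G j i) {m : ℕ} (x : Fin n) (v : Vec (Fin n) m) where

  private
    succ : Fin (suc m) → Fin (suc m)
    succ i = fromℕ< (m%n<n (suc (toℕ i)) (suc m))

    succ-toℕ : ∀ i → suc (toℕ i) % suc m ≡ toℕ (succ i)
    succ-toℕ i = sym (toℕ-fromℕ< (m%n<n (suc (toℕ i)) (suc m)))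

    step : ∀ {i j} → (suc (toℕ i) % suc m ≡ᵇ toℕ j) ≡ true → chain (adj G) x x v ≡ true →
      adj G (Vec.lookup (x ∷ v) i) (Vec.lookup (x ∷ v) j) ≡ true
    step {i} {j} e c = subst (λ y → adj G (Vec.lookup (x ∷ v) i) y ≡ true)
      (lookup-rotate v x i j (≡ᵇ-true⁻ e)) (chain⁻ (adj G) x x v c i)

  isHom-cycle⇒chain : isHom (cycleG (suc m)) G (x ∷ v) ≡ true → chain (adj G) x x v ≡ true
  isHom-cycle⇒chain h = chain⁺ (adj G) x x v λ i →
    subst (λ y → adj G (Vec.lookup (x ∷ v) i) y ≡ true) (sym (lookup-rotate v x i (succ i) (succ-toℕ i)))
      (isHom⁻ (cycleG (suc m)) G (x ∷ v) h i (succ i) (∨-trueˡ (≡ᵇ-true⁺ (succ-toℕ i))))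

  -- A chain controls the edges in the increasing direction; the symmetry of `G` supplies the
  -- reversed ones.
  chain⇒isHom-cycle : chain (adj G) x x v ≡ true → isHom (cycleG (suc m)) G (x ∷ v) ≡ true
  chain⇒isHom-cycle c = isHom⁺ (cycleG (suc m)) G (x ∷ v) λ i j e →
    ∨-true⁻ {suc (toℕ i) % suc m ≡ᵇ toℕ j} e |> λ where
      (inj₁ e₁) → step {i} {j} e₁ c
      (inj₂ e₂) → trans (G-sym _ _) (step {j} {i} e₂ c)

hom-cycle : ∀ {n} (G : Graph n) → (∀ i j → adj G i j ≡ adj G j i) → ∀ m →
  hom (cycleG (suc m)) G ≡ tr (allFin n) (pow (allFin n) m (adjacency G))
hom-cycle {n} G G-sym m = begin
  hom (cycleG (suc m)) G                                                    ≡⟨ hom-∑ (cycleG (suc m)) G ⟩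
  ∑ (tuples (suc m) V) (ind ∘ isHom (cycleG (suc m)) G)                     ≡⟨ ∑-product _∷_ V (tuples m V) _ ⟩
  ∑ V (λ x → ∑ (tuples m V) (λ v → ind (isHom (cycleG (suc m)) G (x ∷ v)))) ≡⟨ ∑-cong V (λ x → ∑-cong (tuples m V) (λ v →
                                                                                 ≤-antisym (ind-mono (isHom-cycle⇒chain G G-sym x v)) (ind-mono (chain⇒isHom-cycle G G-sym x v)))) ⟩
  ∑ V (λ x → ∑ (tuples m V) (λ v → ind (chain (adj G) x x v)))              ≡⟨ ∑-cong V (λ x → ∑-chain (adj G) V m x x) ⟩
  tr V (pow V m (adjacency G))                                              ∎
  where
  open ≡-Reasoning
  V = allFin n

-- Spanning subgraphs

-- The head of `xs` is cut out of `ys` at one occurrence; uniqueness keeps the later elements away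
-- from that place, so they are still found in what remains.
∑-⊆-unique : ∀ {xs ys : List A} (f : A → ℕ) → Unique xs → (∀ {x} → x ∈ xs → x ∈ ys) → ∑ xs f ≤ ∑ ys f
∑-⊆-unique f [] sub = z≤n
∑-⊆-unique {xs = x ∷ xs} f (x∉xs ∷ xs!) sub with ∈-∃++ (sub (here refl))
... | ys₁ , ys₂ , refl = begin
  f x + ∑ xs f                   ≤⟨ +-monoʳ-≤ (f x) (∑-⊆-unique f xs! rest) ⟩
  f x + ∑ (ys₁ ++ ys₂) f         ≡⟨ cong (f x +_) (∑-++ ys₁ ys₂ f) ⟩
  f x + (∑ ys₁ f + ∑ ys₂ f)      ≡⟨ regroup (f x) (∑ ys₁ f) (∑ ys₂ f) ⟩
  ∑ ys₁ f + (f x + ∑ ys₂ f)      ≡⟨ sym (∑-++ ys₁ (x ∷ ys₂) f) ⟩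
  ∑ (ys₁ ++ x ∷ ys₂) f           ∎
  where
  open ≤-Reasoning
  regroup : ∀ a b c → a + (b + c) ≡ b + (a + c)
  regroup = solve-∀
  rest : ∀ {z} → z ∈ xs → z ∈ ys₁ ++ ys₂
  rest z∈xs with ∈-++⁻ ys₁ (sub (there z∈xs))
  ... | inj₁ z∈ys₁           = ∈-++⁺ˡ z∈ys₁
  ... | inj₂ (here refl)     = contradiction refl (All.lookup x∉xs z∈xs)
  ... | inj₂ (there z∈ys₂)   = ∈-++⁺ʳ ys₁ z∈ys₂

∈-tuples : ∀ {L : List A} → (∀ x → x ∈ L) → ∀ {m} (v : Vec A m) → v ∈ tuples m L
∈-tuples full []      = here refl
∈-tuples full (x ∷ v) = ∈-cartesianProductWith⁺ _∷_ (full x) (∈-tuples full v)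

tuples-unique : ∀ {L : List A} → Unique L → ∀ m → Unique (tuples m L)
tuples-unique L! zero    = [] ∷ []
tuples-unique L! (suc m) = Unique.cartesianProductWith⁺ _∷_ Vec.∷-injective L! (tuples-unique L! m)

-- Pigeonhole: if `y` were missed, punching it out would give an injection into a set with one
-- element fewer.
injective⇒onto : ∀ {n} {σ : Fin n → Fin n} → Injective _≡_ _≡_ σ → ∀ y → ∃ λ x → σ x ≡ y
injective⇒onto {suc n} {σ} σ-inj y with any? (λ x → σ x Fin.≟ y)
... | yes p = p
... | no ¬p = contradiction (injective⇒≤ {f = λ x → punchOut (y≢σ x)} (λ eq → σ-inj (punchOut-injective (y≢σ _) (y≢σ _) eq))) 1+n≰n
  where
  y≢σ : ∀ x → y ≢ σ x
  y≢σ x eq = ¬p (x , sym eq)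

-- Composition with `σ` turns homomorphisms from `H` into homomorphisms from `K`, and it is
-- injective on maps because `σ` is onto.
hom-spanning : ∀ {a b} (H K : Graph a) (G : Graph b) (σ : Fin a → Fin a) → Injective _≡_ _≡_ σ →
  (∀ i j → adj K i j ≡ true → adj H (σ i) (σ j) ≡ true) → hom H G ≤ hom K G
hom-spanning {a} {b} H K G σ σ-inj edges = begin
  hom H G                                          ≡⟨ hom-∑ H G ⟩
  ∑ maps (ind ∘ isHom H G)                         ≤⟨ ∑-mono maps (λ v → ind-mono (pullback v)) ⟩
  ∑ maps (λ v → ind (isHom K G (φ v)))             ≡⟨ sym (∑-map φ maps (ind ∘ isHom K G)) ⟩
  ∑ (map φ maps) (ind ∘ isHom K G)                 ≤⟨ ∑-⊆-unique (ind ∘ isHom K G) (Unique.map⁺ φ-inj (tuples-unique (Unique.allFin⁺ b) a)) (λ {v} _ → ∈-tuples ∈-allFin v) ⟩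
  ∑ maps (ind ∘ isHom K G)                         ≡⟨ sym (hom-∑ K G) ⟩
  hom K G                                          ∎
  where
  open ≤-Reasoning
  maps = tuples a (allFin b)
  φ : Vec (Fin b) a → Vec (Fin b) a
  φ v = Vec.tabulate (λ i → Vec.lookup v (σ i))
  lookup-φ : ∀ v i → Vec.lookup (φ v) i ≡ Vec.lookup v (σ i)
  lookup-φ v i = Vec.lookup∘tabulate (λ i → Vec.lookup v (σ i)) i
  φ-inj : ∀ {v w} → φ v ≡ φ w → v ≡ w
  φ-inj {v} {w} eq = trans (sym (Vec.tabulate∘lookup v)) (trans (Vec.tabulate-cong same) (Vec.tabulate∘lookup w))
    where
    same : ∀ y → Vec.lookup v y ≡ Vec.lookup w y
    same y with injective⇒onto σ-inj y
    ... | x , refl = trans (sym (lookup-φ v x)) (trans (cong (λ u → Vec.lookup u x) eq) (lookup-φ w x))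
  pullback : ∀ v → isHom H G v ≡ true → isHom K G (φ v) ≡ true
  pullback v h = isHom⁺ K G (φ v) λ i j e →
    subst₂ (λ s t → adj G s t ≡ true) (sym (lookup-φ v i)) (sym (lookup-φ v j)) (isHom⁻ H G v h (σ i) (σ j) (edges i j e))

-- Admissibility of the exponent

denominator : ∀ e g K → e + g ≡ K + K →
  2 * suc K * suc (suc e) ∸ 2 * suc K ∸ suc (suc e) ≡ g + e * (suc K + suc K)
denominator e g K eq = begin
  2 * suc K * suc (suc e) ∸ 2 * suc K ∸ suc (suc e)     ≡⟨ ∸-+-assoc (2 * suc K * suc (suc e)) (2 * suc K) (suc (suc e)) ⟩
  -- The product is the subtrahend plus `Q`, by `e + g ≡ K + K`, so truncated subtraction is exact
  -- here.
  2 * suc K * suc (suc e) ∸ (2 * suc K + suc (suc e))   ≡⟨ cong (_∸ (2 * suc K + suc (suc e))) split ⟩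
  2 * suc K + suc (suc e) + Q ∸ (2 * suc K + suc (suc e)) ≡⟨ m+n∸m≡n (2 * suc K + suc (suc e)) Q ⟩
  Q                                                     ∎
  where
  open ≡-Reasoning
  Q = g + e * (suc K + suc K)
  lhs : ∀ K e → 2 * suc K * suc (suc e) ≡ 2 * suc K + (e * (suc K + suc K) + 2 + (K + K))
  lhs = solve-∀
  rhs : ∀ K e g → 2 * suc K + (e * (suc K + suc K) + 2 + (e + g)) ≡ 2 * suc K + suc (suc e) + (g + e * (suc K + suc K))
  rhs = solve-∀
  split : 2 * suc K * suc (suc e) ≡ 2 * suc K + suc (suc e) + Q
  split = trans (lhs K e) (trans (cong (λ t → 2 * suc K + (e * (suc K + suc K) + 2 + t)) (sym eq)) (rhs K e g))

numerator : ∀ K → 4 * suc K * K ≡ (K + K) * (suc K + suc K)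
numerator = solve-∀

-- `moment-bound` compares the `p`-th power of the count for the cycle on `ℓ` vertices with the
-- `q`-th power of the count for the even cycle. After multiplication by `N ^ (2kq)` the exponent of
-- `N` is `2kg + 2kq = ℓp`, as admissibility asks.
evenCycle-admissible : ∀ e g K → e + g ≡ K + K → (H : Graph (suc (suc e))) → HasHamiltonianCycle H →
  Admissible (cycleG (2 * suc K)) H (4 * suc K * K) (g + e * (suc K + suc K))
evenCycle-admissible e g K eq H (σ , σ-inj , edges) b G (G-sym , _) = begin
  hom H G ^ p * N ^ (2 * suc K * q)                      ≤⟨ *-monoˡ-≤ (N ^ (2 * suc K * q)) (^-monoˡ-≤ p (hom-spanning H (cycleG (suc (suc e))) G σ σ-inj edges)) ⟩
  hom (cycleG (suc (suc e))) G ^ p * N ^ (2 * suc K * q) ≡⟨ cong₂ (λ s t → s ^ t * N ^ (2 * suc K * q)) (hom-cycle G G-sym (suc e)) (numerator K) ⟩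
  moment e ^ ((K + K) * k₂) * N ^ (2 * suc K * q)        ≤⟨ *-monoˡ-≤ (N ^ (2 * suc K * q)) (moment-bound (λ i j → ind-idem (adj G i j)) e g K eq) ⟩
  n ^ (k₂ * g) * moment (K + K) ^ q * N ^ (2 * suc K * q) ≡⟨ cong (λ t → t ^ (k₂ * g) * moment (K + K) ^ q * N ^ (2 * suc K * q)) (length-tabulate {n = N} (λ i → i)) ⟩
  N ^ (k₂ * g) * moment (K + K) ^ q * N ^ (2 * suc K * q) ≡⟨ xy*z≡y*xz (N ^ (k₂ * g)) (moment (K + K) ^ q) (N ^ (2 * suc K * q)) ⟩
  moment (K + K) ^ q * (N ^ (k₂ * g) * N ^ (2 * suc K * q)) ≡⟨ cong (moment (K + K) ^ q *_) (sym (^-distribˡ-+-* N (k₂ * g) (2 * suc K * q))) ⟩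
  moment (K + K) ^ q * N ^ (k₂ * g + 2 * suc K * q)      ≡⟨ cong₂ (λ s t → s ^ q * N ^ t) (sym even) exponents ⟩
  hom (cycleG (2 * suc K)) G ^ q * N ^ (suc (suc e) * p) ∎
  where
  open ≤-Reasoning
  open SymmetricMatrix (allFin (suc b)) (adjacency G) (λ i j → cong ind (G-sym i j))
  N = suc b
  k₂ = suc K + suc K
  p = 4 * suc K * K
  q = g + e * k₂
  even : hom (cycleG (2 * suc K)) G ≡ moment (K + K)
  -- `2 * suc K` reduces to `suc (K + 1 * suc K)`, which dictates the argument of `hom-cycle`.
  even = trans (hom-cycle G G-sym (K + 1 * suc K))
    (cong (λ t → tr (allFin N) (pow (allFin N) t (adjacency G))) (double K))
    where
    double : ∀ K → K + 1 * suc K ≡ suc (K + K)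
    double = solve-∀
  lhs : ∀ e g K → (suc K + suc K) * g + 2 * suc K * (g + e * (suc K + suc K)) ≡ 2 * suc K * (2 * (e + g) + e * (K + K))
  lhs = solve-∀
  rhs : ∀ e K → 2 * suc K * (2 * (K + K) + e * (K + K)) ≡ suc (suc e) * (4 * suc K * K)
  rhs = solve-∀
  exponents : k₂ * g + 2 * suc K * q ≡ suc (suc e) * p
  exponents = trans (lhs e g K) (trans (cong (λ t → 2 * suc K * (2 * t + e * (K + K))) eq) (rhs e K))

-- Traces of powers of M I + J

module _ (L : List A) (I : Matrix A A) (∑-I : ∀ (x : A) (f : A → ℕ) → ∑ L (λ z → I x z * f z) ≡ f x)
         (I-sym : ∀ x y → I x y ≡ I y x) (I≤1 : ∀ x → I x x ≤ 1) (M : ℕ) where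

  private
    N = length L

    -- The coefficient of the all-ones matrix J in (M I + J)^(m+1); the recurrence comes from J J =
    -- N J.
    β : ℕ → ℕ
    β zero    = 1
    β (suc m) = (M + N) * β m + M ^ suc m

    Q : Matrix A A
    Q x y = M * I x y + 1

    pow-Q : ∀ m x y → pow L m Q x y ≡ M ^ suc m * I x y + β m
    pow-Q zero    x y = cong (λ t → t * I x y + 1) (sym (*-identityʳ M))
    pow-Q (suc m) x y = begin
      ∑ L (λ z → (M * I x z + 1) * pow L m Q z y)                        ≡⟨ ∑-cong L (λ z → cong ((M * I x z + 1) *_) (pow-Q m z y)) ⟩
      ∑ L (λ z → (M * I x z + 1) * (α * I z y + β m))                    ≡⟨ ∑-cong L (λ z → expand M (I x z) α (I z y) (β m)) ⟩
      ∑ L (λ z → M * (I x z * (α * I z y + β m)) + (α * I z y + β m))    ≡⟨ ∑-+ L _ _ ⟩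
      ∑ L (λ z → M * (I x z * (α * I z y + β m))) + ∑ L (λ z → α * I z y + β m)
        ≡⟨ cong₂ _+_ (sym (∑-*ˡ L M _)) (trans (∑-+ L _ _) (cong₂ _+_ (sym (∑-*ˡ L α _)) (∑-const L (β m)))) ⟩
      M * ∑ L (λ z → I x z * (α * I z y + β m)) + (α * ∑ L (λ z → I z y) + N * β m)
        ≡⟨ cong₂ (λ s t → M * s + (α * t + N * β m)) (∑-I x (λ z → α * I z y + β m)) (column y) ⟩
      M * (α * I x y + β m) + (α * 1 + N * β m)                          ≡⟨ collect M α (I x y) (β m) N ⟩
      M * α * I x y + ((M + N) * β m + α)                                ∎
      where
      open ≡-Reasoning
      α = M ^ suc m
      expand : ∀ M i α j b → (M * i + 1) * (α * j + b) ≡ M * (i * (α * j + b)) + (α * j + b)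
      expand = solve-∀
      collect : ∀ M α i b N → M * (α * i + b) + (α * 1 + N * b) ≡ M * α * i + ((M + N) * b + α)
      collect = solve-∀
      column : ∀ y → ∑ L (λ z → I z y) ≡ 1
      column y = trans (∑-cong L (λ z → trans (I-sym z y) (sym (*-identityʳ (I y z))))) (∑-I y (λ _ → 1))

    -- The all-ones vector is an eigenvector of M I + J with eigenvalue M + N, so both sides are the
    -- row sum of the power. This bounds `N * β m` without solving the recurrence.
    row-sum : ∀ m → N * β m + M ^ suc m ≡ (M + N) ^ suc m
    row-sum zero    = base N M
      where
      base : ∀ N M → N * 1 + M * 1 ≡ (M + N) * 1
      base = solve-∀
    row-sum (suc m) = trans (collect N M (β m) (M ^ suc m)) (cong ((M + N) *_) (row-sum m))
      where
      collect : ∀ N M b α → N * ((M + N) * b + α) + M * α ≡ (M + N) * (N * b + α)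
      collect = solve-∀

  tr-pow-MI+J : ∀ m → tr L (pow L m (λ x y → M * I x y + 1)) ≤ N * M ^ suc m + (M + N) ^ suc m
  tr-pow-MI+J m = begin
    ∑ L (λ x → pow L m Q x x)                 ≡⟨ ∑-cong L (λ x → pow-Q m x x) ⟩
    ∑ L (λ x → M ^ suc m * I x x + β m)       ≤⟨ ∑-mono L (λ x → +-monoˡ-≤ (β m) (*-monoʳ-≤ (M ^ suc m) (I≤1 x))) ⟩
    ∑ L (λ x → M ^ suc m * 1 + β m)           ≡⟨ ∑-const L (M ^ suc m * 1 + β m) ⟩
    N * (M ^ suc m * 1 + β m)                 ≡⟨ split N (M ^ suc m) (β m) ⟩
    N * M ^ suc m + N * β m                   ≤⟨ +-monoʳ-≤ (N * M ^ suc m) (m≤m+n (N * β m) (M ^ suc m)) ⟩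
    N * M ^ suc m + (N * β m + M ^ suc m)     ≡⟨ cong (N * M ^ suc m +_) (row-sum m) ⟩
    N * M ^ suc m + (M + N) ^ suc m           ∎
    where
    open ≤-Reasoning
    split : ∀ N a b → N * (a * 1 + b) ≡ N * a + N * b
    split = solve-∀

-- The graph of partially agreeing tuples

_==_ : ∀ {n} → Fin n → Fin n → Bool
x == y = does (x Fin.≟ y)

==-refl : ∀ {n} (x : Fin n) → (x == x) ≡ true
==-refl zero    = refl
==-refl (suc x) = ==-refl x

==-sym : ∀ {n} (x y : Fin n) → (x == y) ≡ (y == x)
==-sym zero    zero    = refl
==-sym zero    (suc y) = refl
==-sym (suc x) zero    = refl
==-sym (suc x) (suc y) = ==-sym x y

==⇒≡ : ∀ {n} (x y : Fin n) → (x == y) ≡ true → x ≡ y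
==⇒≡ zero    zero    eq = refl
==⇒≡ (suc x) (suc y) eq = cong suc (==⇒≡ x y eq)

δ : ∀ {n} → Matrix (Fin n) (Fin n)
δ x y = ind (x == y)

δ-sym : ∀ {n} (x y : Fin n) → δ x y ≡ δ y x
δ-sym x y = cong ind (==-sym x y)

∑-δ : ∀ {n} (x : Fin n) (f : Fin n → ℕ) → ∑ (allFin n) (λ z → δ x z * f z) ≡ f x
∑-δ {suc n} zero f = trans (∑-allFin-suc {n} (λ z → δ zero z * f z))
  (trans (cong₂ _+_ (*-identityˡ (f zero)) (∑-zero (allFin n))) (+-identityʳ (f zero)))
∑-δ {suc n} (suc x) f = trans (∑-allFin-suc {n} (λ z → δ (suc x) z * f z)) (∑-δ x (f ∘ suc))

∑-δʳ : ∀ {n} (x : Fin n) (f : Fin n → ℕ) → ∑ (allFin n) (λ z → δ z x * f z) ≡ f x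
∑-δʳ {n} x f = trans (∑-cong (allFin n) (λ z → cong (_* f z) (δ-sym z x))) (∑-δ x f)

length-∑ : ∀ (L : List A) → length L ≡ ∑ L (λ _ → 1)
length-∑ L = sym (trans (∑-const L 1) (*-identityʳ (length L)))

length-product : ∀ (g : A → B → C) (K : List A) (L : List B) →
  length (cartesianProductWith g K L) ≡ length K * length L
length-product g K L = trans (length-∑ (cartesianProductWith g K L)) (trans (∑-product g K L (λ _ → 1))
  (trans (∑-cong K (λ _ → sym (length-∑ L))) (∑-const K (length L))))

length-tuples : ∀ m (L : List A) → length (tuples m L) ≡ length L ^ m
length-tuples zero    L = refl
length-tuples (suc m) L = trans (length-product _∷_ L (tuples m L)) (cong (length L *_) (length-tuples m L))

length-allFin : ∀ n → length (allFin n) ≡ n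
length-allFin n = length-tabulate (λ i → i)

-- A tuple of pairs is a pair of tuples. This separates colours from vectors, and first coordinates
-- from the remaining ones.
∑-tuples-product : ∀ m (g : A → B → C) (K : List A) (L : List B) (F : Vec C m → ℕ) →
  ∑ (tuples m (cartesianProductWith g K L)) F ≡ ∑ (tuples m K) (λ a → ∑ (tuples m L) (λ y → F (Vec.zipWith g a y)))
∑-tuples-product zero    g K L F = sym (+-identityʳ _)
∑-tuples-product (suc m) g K L F = begin
  ∑ (tuples (suc m) (cartesianProductWith g K L)) F
    ≡⟨ ∑-product _∷_ (cartesianProductWith g K L) (tuples m (cartesianProductWith g K L)) F ⟩
  ∑ (cartesianProductWith g K L) (λ z → ∑ (tuples m (cartesianProductWith g K L)) (λ w → F (z ∷ w)))
    ≡⟨ ∑-product g K L _ ⟩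
  ∑ K (λ a → ∑ L (λ y → ∑ (tuples m (cartesianProductWith g K L)) (λ w → F (g a y ∷ w))))
    ≡⟨ ∑-cong K (λ a → ∑-cong L (λ y → ∑-tuples-product m g K L (λ w → F (g a y ∷ w)))) ⟩
  ∑ K (λ a → ∑ L (λ y → ∑ (tuples m K) (λ as → ∑ (tuples m L) (λ ys → F (g a y ∷ Vec.zipWith g as ys)))))
    ≡⟨ ∑-cong K (λ a → ∑-swap L (tuples m K) _) ⟩
  ∑ K (λ a → ∑ (tuples m K) (λ as → ∑ L (λ y → ∑ (tuples m L) (λ ys → F (g a y ∷ Vec.zipWith g as ys)))))
    ≡⟨ ∑-cong K (λ a → ∑-cong (tuples m K) (λ as → sym (∑-product _∷_ L (tuples m L) (λ ys → F (Vec.zipWith g (a ∷ as) ys))))) ⟩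
  ∑ K (λ a → ∑ (tuples m K) (λ as → ∑ (tuples (suc m) L) (λ ys → F (Vec.zipWith g (a ∷ as) ys))))
    ≡⟨ sym (∑-product _∷_ K (tuples m K) _) ⟩
  ∑ (tuples (suc m) K) (λ as → ∑ (tuples (suc m) L) (λ ys → F (Vec.zipWith g as ys))) ∎
  where open ≡-Reasoning

∑-tuples-lookup : ∀ m (L : List A) (F : Vec A m → ℕ) →
  ∑ (tuples m (allFin (length L))) (λ f → F (Vec.map (lookup L) f)) ≡ ∑ (tuples m L) F
∑-tuples-lookup zero    L F = refl
∑-tuples-lookup (suc m) L F = begin
  ∑ (tuples (suc m) V) (λ f → F (Vec.map (lookup L) f))                       ≡⟨ ∑-product _∷_ V (tuples m V) _ ⟩
  ∑ V (λ i → ∑ (tuples m V) (λ f → F (lookup L i ∷ Vec.map (lookup L) f)))    ≡⟨ ∑-cong V (λ i → ∑-tuples-lookup m L (λ v → F (lookup L i ∷ v))) ⟩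
  ∑ V (λ i → ∑ (tuples m L) (λ v → F (lookup L i ∷ v)))                       ≡⟨ ∑-lookup L (λ x → ∑ (tuples m L) (λ v → F (x ∷ v))) ⟩
  ∑ L (λ x → ∑ (tuples m L) (λ v → F (x ∷ v)))                                ≡⟨ sym (∑-product _∷_ L (tuples m L) F) ⟩
  ∑ (tuples (suc m) L) F                                                      ∎
  where
  open ≡-Reasoning
  V = allFin (length L)

graphOn : (L : List A) → (A → A → Bool) → Graph (length L)
graphOn L R = record { adj = λ i j → R (lookup L i) (lookup L j) }

ind-∨-≤ : ∀ b c → ind (b ∨ c) ≤ ind b + ind c
ind-∨-≤ true  c = s≤s z≤n
ind-∨-≤ false c = ≤-refl

ind-∨ : ∀ b c → ind (b ∨ c) + ind b * ind c ≡ ind b + ind c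
ind-∨ true  c = cong suc (+-identityʳ (ind c))
ind-∨ false c = +-identityʳ (ind c)

module _ {M : ℕ} where

  meet : ∀ {d} → Vec (Fin M) d → Vec (Fin M) d → Bool
  meet []      []      = false
  meet (a ∷ x) (b ∷ y) = (a == b) ∨ meet x y

  meet-sym : ∀ {d} (x y : Vec (Fin M) d) → meet x y ≡ meet y x
  meet-sym []      []      = refl
  meet-sym (a ∷ x) (b ∷ y) = cong₂ _∨_ (==-sym a b) (meet-sym x y)

  -- The union bound over coordinates.
  meet≤agreements : ∀ {d} (x y : Vec (Fin M) d) →
    ind (meet x y) ≤ ∑ (allFin d) (λ i → δ (Vec.lookup x i) (Vec.lookup y i))
  meet≤agreements []      []      = z≤n
  meet≤agreements (a ∷ x) (b ∷ y) = ≤-trans (ind-∨-≤ (a == b) (meet x y))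
    (≤-trans (+-monoʳ-≤ (δ a b) (meet≤agreements x y))
      (≤-reflexive (sym (∑-allFin-suc (λ i → δ (Vec.lookup (a ∷ x) i) (Vec.lookup (b ∷ y) i))))))

  allEqual : ∀ {m} → Fin M → Vec (Fin M) m → Bool
  allEqual a []      = true
  allEqual a (b ∷ v) = (a == b) ∧ allEqual a v

  constant : ∀ {m} → Vec (Fin M) (suc m) → Bool
  constant (a ∷ v) = allEqual a v

  allEqual⇒≡ : ∀ {m} a (v : Vec (Fin M) m) → allEqual a v ≡ true → ∀ i → a ≡ Vec.lookup v i
  allEqual⇒≡ a (b ∷ v) eq i with ∧-true⁻ {a == b} eq
  allEqual⇒≡ a (b ∷ v) eq zero    | h , t = ==⇒≡ a b h
  allEqual⇒≡ a (b ∷ v) eq (suc i) | h , t = allEqual⇒≡ a v t i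

  constant⇒≡ : ∀ {m} (v : Vec (Fin M) (suc m)) → constant v ≡ true → ∀ i j → Vec.lookup v i ≡ Vec.lookup v j
  constant⇒≡ (a ∷ v) eq i j = trans (sym (toHead i)) (toHead j)
    where
    toHead : ∀ i → a ≡ Vec.lookup (a ∷ v) i
    toHead zero    = refl
    toHead (suc i) = allEqual⇒≡ a v eq i

  ∑-constant : ∀ m → ∑ (tuples (suc m) (allFin M)) (ind ∘ constant) ≡ M
  ∑-constant m = begin
    ∑ (tuples (suc m) V) (ind ∘ constant)                   ≡⟨ ∑-product _∷_ V (tuples m V) _ ⟩
    ∑ V (λ a → ∑ (tuples m V) (ind ∘ allEqual a))           ≡⟨ ∑-cong V (∑-allEqual m) ⟩
    ∑ V (λ _ → 1)                                           ≡⟨ sym (length-∑ V) ⟩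
    length V                                                ≡⟨ length-allFin M ⟩
    M                                                       ∎
    where
    open ≡-Reasoning
    V = allFin M
    ∑-allEqual : ∀ m a → ∑ (tuples m V) (ind ∘ allEqual a) ≡ 1
    ∑-allEqual zero    a = refl
    ∑-allEqual (suc m) a = begin
      ∑ (tuples (suc m) V) (ind ∘ allEqual a)                       ≡⟨ ∑-product _∷_ V (tuples m V) _ ⟩
      ∑ V (λ b → ∑ (tuples m V) (λ v → ind ((a == b) ∧ allEqual a v)))
        ≡⟨ ∑-cong V (λ b → trans (∑-cong (tuples m V) (λ v → ind-∧ (a == b) (allEqual a v))) (sym (∑-*ˡ (tuples m V) (δ a b) _))) ⟩
      ∑ V (λ b → δ a b * ∑ (tuples m V) (ind ∘ allEqual a))         ≡⟨ ∑-δ a _ ⟩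
      ∑ (tuples m V) (ind ∘ allEqual a)                             ≡⟨ ∑-allEqual m a ⟩
      1                                                             ∎

  -- Expresses that all vectors of the tuple lie in one common class; such tuples are the copies
  -- counted in the lower bound.
  concur : ∀ {d m} → Vec (Vec (Fin M) d) (suc m) → Bool
  concur {zero}  w = false
  concur {suc d} w = constant (Vec.map Vec.head w) ∨ concur (Vec.map Vec.tail w)

  concur⇒meet : ∀ {d m} (w : Vec (Vec (Fin M) d) (suc m)) → concur w ≡ true →
    ∀ i j → meet (Vec.lookup w i) (Vec.lookup w j) ≡ true
  concur⇒meet {suc d} w eq i j with Vec.lookup w i in wi | Vec.lookup w j in wj | ∨-true⁻ {constant (Vec.map Vec.head w)} eq
  ... | a ∷ x | b ∷ y | inj₁ c = ∨-trueˡ (trans (cong (_== b) a≡b) (==-refl b))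
    where
    a≡b : a ≡ b
    a≡b = trans (sym (trans (Vec.lookup-map i Vec.head w) (cong Vec.head wi)))
      (trans (constant⇒≡ (Vec.map Vec.head w) c i j) (trans (Vec.lookup-map j Vec.head w) (cong Vec.head wj)))
  ... | a ∷ x | b ∷ y | inj₂ c = ∨-trueʳ (subst₂ (λ s t → meet s t ≡ true)
      (trans (Vec.lookup-map i Vec.tail w) (cong Vec.tail wi))
      (trans (Vec.lookup-map j Vec.tail w) (cong Vec.tail wj))
      (concur⇒meet (Vec.map Vec.tail w) c i j))
    where
    ∨-trueʳ : ∀ {b c} → c ≡ true → b ∨ c ≡ true
    ∨-trueʳ {true}  _ = refl
    ∨-trueʳ {false} e = e

  map-head-zipWith : ∀ {d m} (a : Vec (Fin M) m) (y : Vec (Vec (Fin M) d) m) → Vec.map Vec.head (Vec.zipWith _∷_ a y) ≡ a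
  map-head-zipWith []      []      = refl
  map-head-zipWith (a ∷ v) (x ∷ y) = cong (a ∷_) (map-head-zipWith v y)

  map-tail-zipWith : ∀ {d m} (a : Vec (Fin M) m) (y : Vec (Vec (Fin M) d) m) → Vec.map Vec.tail (Vec.zipWith _∷_ a y) ≡ y
  map-tail-zipWith []      []      = refl
  map-tail-zipWith (a ∷ v) (x ∷ y) = cong (x ∷_) (map-tail-zipWith v y)

  vecs : ∀ d → List (Vec (Fin M) d)
  vecs d = tuples d (allFin M)

  length-vecs : ∀ d → length (vecs d) ≡ M ^ d
  length-vecs d = trans (length-tuples d (allFin M)) (cong (_^ d) (length-allFin M))

  -- Inclusion–exclusion for the events "coordinate 1 is constant" and "some later coordinate is constant".
  ∑-concur-suc : ∀ m d →
    ∑ (tuples (suc m) (vecs (suc d))) (ind ∘ concur) + M * ∑ (tuples (suc m) (vecs d)) (ind ∘ concur)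
    ≡ M * (M ^ d) ^ suc m + M ^ suc m * ∑ (tuples (suc m) (vecs d)) (ind ∘ concur)
  ∑-concur-suc m d = begin
    ∑ (tuples (suc m) (vecs (suc d))) (ind ∘ concur) + M * E
      ≡⟨ cong₂ _+_ (trans (∑-tuples-product (suc m) _∷_ V (vecs d) (ind ∘ concur)) (∑-cong W₁ (λ a → ∑-cong W₂ (λ y → split a y))))
          (trans (cong (_* E) (sym (∑-constant m))) (trans (∑-*ʳ W₁ E (ind ∘ constant)) (∑-cong W₁ (λ a → ∑-*ˡ W₂ (ind (constant a)) (ind ∘ concur))))) ⟩
    ∑ W₁ (λ a → ∑ W₂ (λ y → ind (constant a ∨ concur y))) + ∑ W₁ (λ a → ∑ W₂ (λ y → ind (constant a) * ind (concur y)))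
      ≡⟨ sym (∑-+ W₁ _ _) ⟩
    ∑ W₁ (λ a → ∑ W₂ (λ y → ind (constant a ∨ concur y)) + ∑ W₂ (λ y → ind (constant a) * ind (concur y)))
      ≡⟨ ∑-cong W₁ (λ a → trans (sym (∑-+ W₂ _ _)) (trans (∑-cong W₂ (λ y → ind-∨ (constant a) (concur y))) (∑-+ W₂ _ _))) ⟩
    ∑ W₁ (λ a → ∑ W₂ (λ y → ind (constant a)) + E)
      ≡⟨ ∑-+ W₁ _ _ ⟩
    ∑ W₁ (λ a → ∑ W₂ (λ y → ind (constant a))) + ∑ W₁ (λ _ → E)
      ≡⟨ cong₂ _+_ (trans (∑-cong W₁ (λ a → trans (∑-const W₂ (ind (constant a))) (*-comm (length W₂) _))) (trans (sym (∑-*ʳ W₁ (length W₂) _)) (cong (_* length W₂) (∑-constant m)))) (∑-const W₁ E) ⟩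
    M * length W₂ + length W₁ * E
      ≡⟨ cong₂ (λ s t → M * s + t * E) (trans (length-tuples (suc m) (vecs d)) (cong (_^ suc m) (length-vecs d)))
          (trans (length-tuples (suc m) V) (cong (_^ suc m) (length-allFin M))) ⟩
    M * (M ^ d) ^ suc m + M ^ suc m * E ∎
    where
    open ≡-Reasoning
    V = allFin M
    W₁ = tuples (suc m) V
    W₂ = tuples (suc m) (vecs d)
    E = ∑ W₂ (ind ∘ concur)
    split : ∀ a y → ind (concur (Vec.zipWith _∷_ a y)) ≡ ind (constant a ∨ concur y)
    split a y = cong₂ (λ s t → ind (constant s ∨ concur t)) (map-head-zipWith a y) (map-tail-zipWith a y)

  -- For positive `M` and `q = M ^ m`, a coordinate of a uniformly random tuple is constant with
  -- probability 1/q. If `d` coordinates succeed with probability at least d/(2q), a further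
  -- independent one raises this to at least 1/q + (1 - 1/q) d/(2q), which is at least (d + 1)/(2q)
  -- when d ≤ q.
  ∑-concur-≥ : ∀ m d → d ≤ M ^ m →
    d * (M ^ d) ^ suc m ≤ 2 * M ^ m * ∑ (tuples (suc m) (vecs d)) (ind ∘ concur)
  ∑-concur-≥ m zero    d≤q = z≤n
  ∑-concur-≥ m (suc d) d<q = subst (λ t → suc d * t ≤ 2 * M ^ m * ∑ (tuples (suc m) (vecs (suc d))) (ind ∘ concur))
    (sym (^-distribʳ-* M (M ^ d) (suc m)))
    (step d M (M ^ m) ((M ^ d) ^ suc m) _ _ (∑-concur-suc m d) (∑-concur-≥ m d (≤-trans (n≤1+n d) d<q)) d<q)
    where
    step : ∀ d M q W E E′ → E′ + M * E ≡ M * W + M * q * E → d * W ≤ 2 * q * E → d < q →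
      suc d * (M * q * W) ≤ 2 * q * E′
    step d M q@(suc r) W E E′ rec ih (s≤s d≤r) = begin
      suc d * (M * q * W)                                    ≡⟨ expand d M r W ⟩
      d * (M * W) + q * (M * W) + r * M * (d * W)            ≤⟨ +-mono-≤ (+-monoˡ-≤ (q * (M * W)) (*-monoˡ-≤ (M * W) (≤-trans d≤r (n≤1+n r)))) (*-monoʳ-≤ (r * M) ih) ⟩
      q * (M * W) + q * (M * W) + r * M * (2 * q * E)        ≡⟨ collect M r W E ⟩
      2 * q * (M * W + M * r * E)                            ≡⟨ cong (2 * q *_) (sym cancelled) ⟩
      2 * q * E′                                             ∎
      where
      open ≤-Reasoning
      expand : ∀ d M r W → suc d * (M * suc r * W) ≡ d * (M * W) + suc r * (M * W) + r * M * (d * W)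
      expand = solve-∀
      collect : ∀ M r W E → suc r * (M * W) + suc r * (M * W) + r * M * (2 * suc r * E) ≡ 2 * suc r * (M * W + M * r * E)
      collect = solve-∀
      separate : ∀ M r W E → M * W + M * suc r * E ≡ M * W + M * r * E + M * E
      separate = solve-∀
      cancelled : E′ ≡ M * W + M * r * E
      cancelled = +-cancelʳ-≡ (M * E) E′ (M * W + M * r * E) (trans rec (separate M r W E))

  ∑-vecs-suc : ∀ d (F : Vec (Fin M) (suc d) → ℕ) →
    ∑ (vecs (suc d)) F ≡ ∑ (allFin M) (λ c → ∑ (vecs d) (λ x → F (c ∷ x)))
  ∑-vecs-suc d F = ∑-product _∷_ (allFin M) (vecs d) F

  ∑-head : ∀ d a (g : Vec (Fin M) d → ℕ) → ∑ (vecs (suc d)) (λ v → δ (Vec.head v) a * g (Vec.tail v)) ≡ ∑ (vecs d) g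
  ∑-head d a g = trans (∑-vecs-suc d _)
    (trans (∑-cong (allFin M) (λ c → sym (∑-*ˡ (vecs d) (δ c a) g))) (∑-δʳ a (λ _ → ∑ (vecs d) g)))

  ∑-tail : ∀ d (g : Vec (Fin M) d → ℕ) → ∑ (vecs (suc d)) (g ∘ Vec.tail) ≡ M * ∑ (vecs d) g
  ∑-tail d g = trans (∑-vecs-suc d _)
    (trans (∑-const (allFin M) (∑ (vecs d) g)) (cong (_* ∑ (vecs d) g) (length-allFin M)))

  ∑-coordinate : ∀ {d} (i : Fin d) a → M * ∑ (vecs d) (λ x → δ (Vec.lookup x i) a) ≡ M ^ d
  ∑-coordinate {suc d} zero a = cong (M *_) (begin
    ∑ (vecs (suc d)) (λ x → δ (Vec.lookup x zero) a)        ≡⟨ ∑-cong (vecs (suc d)) (λ { (c ∷ x) → sym (*-identityʳ (δ c a)) }) ⟩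
    ∑ (vecs (suc d)) (λ x → δ (Vec.head x) a * 1)           ≡⟨ ∑-head d a (λ _ → 1) ⟩
    ∑ (vecs d) (λ _ → 1)                                    ≡⟨ sym (length-∑ (vecs d)) ⟩
    length (vecs d)                                         ≡⟨ length-vecs d ⟩
    M ^ d                                                   ∎)
    where open ≡-Reasoning
  ∑-coordinate {suc d} (suc i) a = cong (M *_) (begin
    ∑ (vecs (suc d)) (λ x → δ (Vec.lookup x (suc i)) a)     ≡⟨ ∑-cong (vecs (suc d)) (λ { (c ∷ x) → refl }) ⟩
    ∑ (vecs (suc d)) (g ∘ Vec.tail)                         ≡⟨ ∑-tail d g ⟩
    M * ∑ (vecs d) g                                        ≡⟨ ∑-coordinate i a ⟩
    M ^ d                                                   ∎)
    where
    open ≡-Reasoning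
    g : Vec (Fin M) d → ℕ
    g x = δ (Vec.lookup x i) a

  -- Distinct coordinates are independent; equal ones contribute the diagonal term.
  ∑-coordinates : ∀ {d} (i j : Fin d) a b →
    M * M * ∑ (vecs d) (λ x → δ (Vec.lookup x i) a * δ (Vec.lookup x j) b) ≤ M ^ d * (M * (δ i j * δ a b) + 1)
  ∑-coordinates {suc d} zero zero a b = begin
    M * M * ∑ (vecs (suc d)) (λ x → δ (Vec.lookup x zero) a * δ (Vec.lookup x zero) b)
      ≡⟨ cong (M * M *_) (trans (∑-vecs-suc d _) (∑-cong (allFin M) (λ c → trans (∑-const (vecs d) (δ c a * δ c b)) (x*yz≡y*xz (length (vecs d)) (δ c a) (δ c b))))) ⟩
    M * M * ∑ (allFin M) (λ c → δ c a * (length (vecs d) * δ c b))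
      ≡⟨ cong (M * M *_) (trans (∑-δʳ a _) (cong (_* δ a b) (length-vecs d))) ⟩
    M * M * (M ^ d * δ a b)                                 ≡⟨ regroup M (M ^ d) (δ a b) ⟩
    M * M ^ d * (M * (1 * δ a b))                           ≤⟨ *-monoʳ-≤ (M * M ^ d) (m≤m+n _ 1) ⟩
    M * M ^ d * (M * (1 * δ a b) + 1)                       ∎
    where
    open ≤-Reasoning
    regroup : ∀ M w t → M * M * (w * t) ≡ M * w * (M * (1 * t))
    regroup = solve-∀
  ∑-coordinates {suc d} zero (suc j) a b = ≤-reflexive (begin
    M * M * ∑ (vecs (suc d)) (λ x → δ (Vec.lookup x zero) a * δ (Vec.lookup x (suc j)) b)
      ≡⟨ cong (M * M *_) (trans (∑-cong (vecs (suc d)) (λ { (c ∷ x) → refl })) (∑-head d a (λ x → δ (Vec.lookup x j) b))) ⟩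
    M * M * ∑ (vecs d) (λ x → δ (Vec.lookup x j) b)         ≡⟨ *-assoc M M _ ⟩
    M * (M * ∑ (vecs d) (λ x → δ (Vec.lookup x j) b))       ≡⟨ cong (M *_) (∑-coordinate j b) ⟩
    M * M ^ d                                               ≡⟨ pad M (M ^ d) ⟩
    M * M ^ d * (M * 0 + 1)                                 ∎)
    where
    open ≡-Reasoning
    pad : ∀ M w → M * w ≡ M * w * (M * 0 + 1)
    pad = solve-∀
  ∑-coordinates {suc d} (suc i) zero a b = ≤-reflexive (begin
    M * M * ∑ (vecs (suc d)) (λ x → δ (Vec.lookup x (suc i)) a * δ (Vec.lookup x zero) b)
      ≡⟨ cong (M * M *_) (trans (∑-cong (vecs (suc d)) (λ { (c ∷ x) → *-comm (δ (Vec.lookup x i) a) (δ c b) })) (∑-head d b (λ x → δ (Vec.lookup x i) a))) ⟩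
    M * M * ∑ (vecs d) (λ x → δ (Vec.lookup x i) a)         ≡⟨ *-assoc M M _ ⟩
    M * (M * ∑ (vecs d) (λ x → δ (Vec.lookup x i) a))       ≡⟨ cong (M *_) (∑-coordinate i a) ⟩
    M * M ^ d                                               ≡⟨ pad M (M ^ d) ⟩
    M * M ^ d * (M * 0 + 1)                                 ∎)
    where
    open ≡-Reasoning
    pad : ∀ M w → M * w ≡ M * w * (M * 0 + 1)
    pad = solve-∀
  ∑-coordinates {suc d} (suc i) (suc j) a b = begin
    M * M * ∑ (vecs (suc d)) (λ x → δ (Vec.lookup x (suc i)) a * δ (Vec.lookup x (suc j)) b)
      ≡⟨ cong (M * M *_) (trans (∑-cong (vecs (suc d)) (λ { (c ∷ x) → refl })) (∑-tail d (λ x → δ (Vec.lookup x i) a * δ (Vec.lookup x j) b))) ⟩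
    M * M * (M * S)                                         ≡⟨ *-comm (M * M) (M * S) ⟩
    M * S * (M * M)                                         ≡⟨ trans (*-assoc M S (M * M)) (cong (M *_) (*-comm S (M * M))) ⟩
    M * (M * M * S)                                         ≤⟨ *-monoʳ-≤ M (∑-coordinates i j a b) ⟩
    M * (M ^ d * (M * (δ i j * δ a b) + 1))                 ≡⟨ sym (*-assoc M (M ^ d) _) ⟩
    M * M ^ d * (M * (δ i j * δ a b) + 1)                   ∎
    where
    open ≤-Reasoning
    S = ∑ (vecs d) (λ x → δ (Vec.lookup x i) a * δ (Vec.lookup x j) b)

-- Homomorphism counts into the constructed graph

module Construction (h′ M d : ℕ) where
  h = suc h′

  Label : Set
  Label = Fin h × Vec (Fin M) d

  labels : List Label
  labels = cartesianProduct (allFin h) (vecs d)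

  related : Label → Label → Bool
  related (c , x) (c′ , y) = not (c == c′) ∧ meet x y

  target : Graph (length labels)
  target = graphOn labels related

  related-sym : ∀ u v → related u v ≡ related v u
  related-sym (c , x) (c′ , y) = cong₂ (λ s t → not s ∧ t) (==-sym c c′) (meet-sym x y)

  related-irrefl : ∀ u → related u u ≡ false
  related-irrefl (c , x) rewrite ==-refl c = refl

  length-labels : length labels ≡ h * M ^ d
  length-labels = trans (length-product _,_ (allFin h) (vecs d)) (cong₂ _*_ (length-allFin h) (length-vecs d))

  -- The key `(i , a)` names the class of vertices whose coordinate `i` equals `a`.
  keys : List (Fin d × Fin M)
  keys = cartesianProduct (allFin d) (allFin M)

  length-keys : length keys ≡ d * M
  length-keys = trans (length-product _,_ (allFin d) (allFin M)) (cong₂ _*_ (length-allFin d) (length-allFin M))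

  incidence : Matrix Label (Fin d × Fin M)
  incidence (c , x) (i , a) = δ (Vec.lookup x i) a

  -- The matrix product counts the classes shared by two vertices, that is, the coordinates in which
  -- their vectors agree; omitting the condition on colours only enlarges the left side.
  related≤incidence : ∀ u v → ind (related u v) ≤ mul keys incidence (transpose incidence) u v
  related≤incidence (c , x) (c′ , y) = begin
    ind (not (c == c′) ∧ meet x y)                                  ≤⟨ ind-mono {not (c == c′) ∧ meet x y} (λ e → proj₂ (∧-true⁻ {not (c == c′)} e)) ⟩
    ind (meet x y)                                                  ≤⟨ meet≤agreements x y ⟩
    ∑ (allFin d) (λ i → δ (Vec.lookup x i) (Vec.lookup y i))        ≡⟨ ∑-cong (allFin d) (λ i → trans (δ-sym (Vec.lookup x i) (Vec.lookup y i)) (sym (∑-δ (Vec.lookup x i) (δ (Vec.lookup y i))))) ⟩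
    ∑ (allFin d) (λ i → ∑ (allFin M) (λ a → δ (Vec.lookup x i) a * δ (Vec.lookup y i) a))
      ≡⟨ sym (∑-product _,_ (allFin d) (allFin M) _) ⟩
    mul keys incidence (transpose incidence) (c , x) (c′ , y)       ∎
    where open ≤-Reasoning

  identity : Matrix (Fin d × Fin M) (Fin d × Fin M)
  identity (i , a) (j , b) = δ i j * δ a b

  ∑-identity : ∀ u (f : Fin d × Fin M → ℕ) → ∑ keys (λ z → identity u z * f z) ≡ f u
  ∑-identity (i , a) f = begin
    ∑ keys (λ z → identity (i , a) z * f z)                                   ≡⟨ ∑-product _,_ (allFin d) (allFin M) _ ⟩
    ∑ (allFin d) (λ j → ∑ (allFin M) (λ b → δ i j * δ a b * f (j , b)))       ≡⟨ ∑-cong (allFin d) (λ j → trans (∑-cong (allFin M) (λ b → *-assoc (δ i j) (δ a b) _)) (sym (∑-*ˡ (allFin M) (δ i j) _))) ⟩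
    ∑ (allFin d) (λ j → δ i j * ∑ (allFin M) (λ b → δ a b * f (j , b)))       ≡⟨ ∑-δ i _ ⟩
    ∑ (allFin M) (λ b → δ a b * f (i , b))                                    ≡⟨ ∑-δ a _ ⟩
    f (i , a)                                                                 ∎
    where open ≡-Reasoning

  -- An entry of the Gram matrix counts the vertices common to two classes. These are a fraction 1/M
  -- of all vertices on the diagonal, none for two values of one coordinate, and 1/M² for different
  -- coordinates; the factor `M * M` clears denominators.
  gram-bound : ∀ u v → M * M * mul labels (transpose incidence) incidence u v ≤ length labels * (M * identity u v + 1)
  gram-bound (i , a) (j , b) = begin
    M * M * mul labels (transpose incidence) incidence (i , a) (j , b)        ≡⟨ cong (M * M *_) (∑-product _,_ (allFin h) (vecs d) _) ⟩
    M * M * ∑ (allFin h) (λ _ → S)                                            ≡⟨ cong (M * M *_) (trans (∑-const (allFin h) S) (cong (_* S) (length-allFin h))) ⟩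
    M * M * (h * S)                                                           ≡⟨ x*yz≡y*xz (M * M) h S ⟩
    h * (M * M * S)                                                           ≤⟨ *-monoʳ-≤ h (∑-coordinates i j a b) ⟩
    h * (M ^ d * (M * (δ i j * δ a b) + 1))                                   ≡⟨ sym (*-assoc h (M ^ d) _) ⟩
    h * M ^ d * (M * (δ i j * δ a b) + 1)                                     ≡⟨ cong (_* (M * (δ i j * δ a b) + 1)) (sym length-labels) ⟩
    length labels * (M * (δ i j * δ a b) + 1)                                 ∎
    where
    open ≤-Reasoning
    S = ∑ (vecs d) (λ x → δ (Vec.lookup x i) a * δ (Vec.lookup x j) b)

  -- The adjacency matrix is bounded entrywise by B Bᵀ, the trace of whose power equals that of Bᵀ
  -- B. There `gram-bound` replaces the matrix by a multiple of M I + J, whose powers have a known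
  -- trace bound.
  hom-cycle-target-≤ : ∀ m → (M * M) ^ suc m * hom (cycleG (suc m)) target
    ≤ length labels ^ suc m * (d * M * M ^ suc m + (M + d * M) ^ suc m)
  hom-cycle-target-≤ m = begin
    (M * M) ^ suc m * hom (cycleG (suc m)) target
      ≡⟨ cong ((M * M) ^ suc m *_) (trans (hom-cycle target (λ i j → related-sym (lookup labels i) (lookup labels j)) m) (tr-pow-lookup labels (λ u v → ind (related u v)) m)) ⟩
    (M * M) ^ suc m * tr labels (pow labels m (λ u v → ind (related u v)))
      ≤⟨ *-monoʳ-≤ ((M * M) ^ suc m) (∑-mono labels (λ u → pow-mono₁ u)) ⟩
    (M * M) ^ suc m * tr labels (pow labels m (mul keys incidence (transpose incidence)))
      ≡⟨ cong ((M * M) ^ suc m *_) (tr-pow-mul-comm labels keys incidence (transpose incidence) m) ⟩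
    (M * M) ^ suc m * tr keys (pow keys m (mul labels (transpose incidence) incidence))
      ≡⟨ ∑-*ˡ keys ((M * M) ^ suc m) _ ⟩
    ∑ keys (λ u → (M * M) ^ suc m * pow keys m (mul labels (transpose incidence) incidence) u u)
      ≤⟨ ∑-mono keys (λ u → pow-mono keys (M * M) (length labels) gram-bound m u u) ⟩
    ∑ keys (λ u → length labels ^ suc m * pow keys m (λ u v → M * identity u v + 1) u u)
      ≡⟨ sym (∑-*ˡ keys (length labels ^ suc m) _) ⟩
    length labels ^ suc m * tr keys (pow keys m (λ u v → M * identity u v + 1))
      ≤⟨ *-monoʳ-≤ (length labels ^ suc m) (tr-pow-MI+J keys identity ∑-identity identity-sym identity≤1 M m) ⟩
    length labels ^ suc m * (length keys * M ^ suc m + (M + length keys) ^ suc m)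
      ≡⟨ cong (λ t → length labels ^ suc m * (t * M ^ suc m + (M + t) ^ suc m)) length-keys ⟩
    length labels ^ suc m * (d * M * M ^ suc m + (M + d * M) ^ suc m) ∎
    where
    open ≤-Reasoning
    identity-sym : ∀ u v → identity u v ≡ identity v u
    identity-sym (i , a) (j , b) = cong₂ _*_ (δ-sym i j) (δ-sym a b)
    identity≤1 : ∀ u → identity u u ≤ 1
    identity≤1 (i , a) rewrite ==-refl i | ==-refl a = ≤-refl
    unit : ∀ n t → 1 ^ n * t ≡ t
    unit n t = trans (cong (_* t) (^-zeroˡ n)) (*-identityˡ t)
    pow-mono₁ : ∀ u → pow labels m (λ u v → ind (related u v)) u u ≤ pow labels m (mul keys incidence (transpose incidence)) u u
    pow-mono₁ u = subst₂ _≤_ (unit (suc m) _) (unit (suc m) _)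
      (pow-mono labels 1 1 (λ x y → *-monoʳ-≤ 1 (related≤incidence x y)) m u u)

  -- Only the colouring that gives vertex `i` of `H` the colour `i` is kept. Adjacent vertices then
  -- have different colours, so every concurring tuple of vectors is a homomorphism.
  hom-target-≥ : (H : Graph h) → (∀ i → adj H i i ≡ false) → d ≤ M ^ h′ →
    d * (M ^ d) ^ h ≤ 2 * M ^ h′ * hom H target
  hom-target-≥ H H-irrefl d≤ = begin
    d * (M ^ d) ^ h                                                            ≤⟨ ∑-concur-≥ h′ d d≤ ⟩
    2 * M ^ h′ * ∑ (tuples h (vecs d)) (ind ∘ concur)                          ≤⟨ *-monoʳ-≤ (2 * M ^ h′) (∑-mono (tuples h (vecs d)) (λ y → ind-mono (rainbow y))) ⟩
    2 * M ^ h′ * ∑ (tuples h (vecs d)) (λ y → ind (edges⊆ (Vec.zip (Vec.allFin h) y)))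
      ≤⟨ *-monoʳ-≤ (2 * M ^ h′) (term≤∑ (λ c → ∑ (tuples h (vecs d)) (λ y → ind (edges⊆ (Vec.zip c y)))) (∈-tuples ∈-allFin (Vec.allFin h))) ⟩
    2 * M ^ h′ * ∑ (tuples h (allFin h)) (λ c → ∑ (tuples h (vecs d)) (λ y → ind (edges⊆ (Vec.zip c y))))
      ≡⟨ cong (2 * M ^ h′ *_) (sym (∑-tuples-product h _,_ (allFin h) (vecs d) (ind ∘ edges⊆))) ⟩
    2 * M ^ h′ * ∑ (tuples h labels) (ind ∘ edges⊆)                            ≡⟨ cong (2 * M ^ h′ *_) (sym (∑-tuples-lookup h labels (ind ∘ edges⊆))) ⟩
    2 * M ^ h′ * ∑ (tuples h (allFin (length labels))) (λ f → ind (edges⊆ (Vec.map (lookup labels) f)))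
      ≤⟨ *-monoʳ-≤ (2 * M ^ h′) (∑-mono (tuples h (allFin (length labels))) (λ f → ind-mono (edges⊆⇒isHom f))) ⟩
    2 * M ^ h′ * ∑ (tuples h (allFin (length labels))) (ind ∘ isHom H target)  ≡⟨ cong (2 * M ^ h′ *_) (sym (hom-∑ H target)) ⟩
    2 * M ^ h′ * hom H target                                                  ∎
    where
    open ≤-Reasoning
    edges⊆ : Vec Label h → Bool
    edges⊆ v = all (λ i → all (λ j → not (adj H i j) ∨ related (Vec.lookup v i) (Vec.lookup v j)) (allFin h)) (allFin h)
    edges⊆⇒isHom : ∀ f → edges⊆ (Vec.map (lookup labels) f) ≡ true → isHom H target f ≡ true
    edges⊆⇒isHom f e = isHom⁺ H target f λ i j a → subst₂ (λ s t → related s t ≡ true)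
      (Vec.lookup-map i (lookup labels) f) (Vec.lookup-map j (lookup labels) f)
      (not-∨-true⁻ (all-tabulate⁻ _ (λ j → j) (all-tabulate⁻ _ (λ i → i) e i) j) a)
    rainbow : ∀ y → concur y ≡ true → edges⊆ (Vec.zip (Vec.allFin h) y) ≡ true
    rainbow y e = all-tabulate⁺ _ (λ i → i) λ i → all-tabulate⁺ _ (λ j → j) λ j → not-∨-true⁺ λ a →
      subst₂ (λ s t → related s t ≡ true) (sym (label i)) (sym (label j)) (cong₂ (λ s t → not s ∧ t) (distinct i j a) (concur⇒meet y e i j))
      where
      label : ∀ i → Vec.lookup (Vec.zip (Vec.allFin h) y) i ≡ (i , Vec.lookup y i)
      label i = trans (Vec.lookup-zip i (Vec.allFin h) y) (cong (_, Vec.lookup y i) (Vec.lookup-allFin i))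
      distinct : ∀ i j → adj H i j ≡ true → (i == j) ≡ false
      distinct i j a with i == j in eq
      ... | false = refl
      ... | true with ==⇒≡ i j eq
      ... | refl = contradiction (trans (sym a) (H-irrefl i)) λ ()

-- Sharpness

-- `Admissible` speaks of graphs on `suc b` vertices, so the list is matched as a nonempty one to
-- expose its length as a successor.
admissible-graphOn : ∀ {g h} {G : Graph g} {H : Graph h} {p q} → Admissible G H p q →
  (L : List A) (R : A → A → Bool) → (∀ u v → R u v ≡ R v u) → (∀ u → R u u ≡ false) → 0 < length L →
  hom H (graphOn L R) ^ p * length L ^ (g * q) ≤ hom G (graphOn L R) ^ q * length L ^ (h * p)
admissible-graphOn adm L@(_ ∷ xs) R R-sym R-irrefl _ = adm (length xs) (graphOn L R)
  ((λ i j → R-sym (lookup L i) (lookup L j)) , (λ i → R-irrefl (lookup L i)))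

-- The lower bound to the power `p` and the upper bound to the power `q` are chained through the
-- admissibility inequality. All powers of `n` cancel, leaving a comparison between `d`, `X` and `Y`
-- up to constants.
combine : ∀ {d n X Y c₁ c₂ hH hG} a b p q .{{_ : NonZero n}} →
  d * n ^ a ≤ c₂ * X * hH → Y * hG ≤ n ^ b * (d ^ b * c₁) →
  hH ^ p * n ^ (b * q) ≤ hG ^ q * n ^ (a * p) →
  d ^ p * Y ^ q ≤ c₂ ^ p * c₁ ^ q * (X ^ p * d ^ (b * q))
combine {d} {n} {X} {Y} {c₁} {c₂} {hH} {hG} a b p q lower upper adm =
  *-cancelˡ-≤ (n ^ (a * p) * n ^ (b * q)) {{m*n≢0 _ _ {{m^n≢0 n (a * p)}} {{m^n≢0 n (b * q)}}}} (begin
    n ^ (a * p) * n ^ (b * q) * (d ^ p * Y ^ q)                      ≡⟨ r₁ (n ^ (a * p)) (n ^ (b * q)) (d ^ p) (Y ^ q) ⟩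
    d ^ p * n ^ (a * p) * (n ^ (b * q) * Y ^ q)                      ≡⟨ cong (_* (n ^ (b * q) * Y ^ q)) (trans (cong (d ^ p *_) (sym (^-*-assoc n a p))) (sym (^-distribʳ-* d (n ^ a) p))) ⟩
    (d * n ^ a) ^ p * (n ^ (b * q) * Y ^ q)                          ≤⟨ *-monoˡ-≤ (n ^ (b * q) * Y ^ q) (^-monoˡ-≤ p lower) ⟩
    (c₂ * X * hH) ^ p * (n ^ (b * q) * Y ^ q)                        ≡⟨ cong (_* (n ^ (b * q) * Y ^ q)) (^-distribʳ-* (c₂ * X) hH p) ⟩
    (c₂ * X) ^ p * hH ^ p * (n ^ (b * q) * Y ^ q)                    ≡⟨ r₂ ((c₂ * X) ^ p) (hH ^ p) (n ^ (b * q)) (Y ^ q) ⟩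
    (c₂ * X) ^ p * Y ^ q * (hH ^ p * n ^ (b * q))                    ≤⟨ *-monoʳ-≤ ((c₂ * X) ^ p * Y ^ q) adm ⟩
    (c₂ * X) ^ p * Y ^ q * (hG ^ q * n ^ (a * p))                    ≡⟨ r₂ ((c₂ * X) ^ p) (Y ^ q) (hG ^ q) (n ^ (a * p)) ⟩
    (c₂ * X) ^ p * n ^ (a * p) * (Y ^ q * hG ^ q)                    ≡⟨ cong ((c₂ * X) ^ p * n ^ (a * p) *_) (sym (^-distribʳ-* Y hG q)) ⟩
    (c₂ * X) ^ p * n ^ (a * p) * (Y * hG) ^ q                        ≤⟨ *-monoʳ-≤ ((c₂ * X) ^ p * n ^ (a * p)) (^-monoˡ-≤ q upper) ⟩
    (c₂ * X) ^ p * n ^ (a * p) * (n ^ b * (d ^ b * c₁)) ^ q          ≡⟨ cong₂ (λ s t → s * n ^ (a * p) * t) (^-distribʳ-* c₂ X p) distrib ⟩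
    c₂ ^ p * X ^ p * n ^ (a * p) * (n ^ (b * q) * (d ^ (b * q) * c₁ ^ q)) ≡⟨ r₃ (c₂ ^ p) (X ^ p) (n ^ (a * p)) (n ^ (b * q)) (d ^ (b * q)) (c₁ ^ q) ⟩
    n ^ (a * p) * n ^ (b * q) * (c₂ ^ p * c₁ ^ q * (X ^ p * d ^ (b * q))) ∎)
  where
  open ≤-Reasoning
  r₁ : ∀ u v w z → u * v * (w * z) ≡ w * u * (v * z)
  r₁ = solve-∀
  r₂ : ∀ u v w z → u * v * (w * z) ≡ u * z * (v * w)
  r₂ = solve-∀
  r₃ : ∀ a b c d e f → a * b * c * (d * (e * f)) ≡ c * d * (a * f * (b * e))
  r₃ = solve-∀
  distrib : (n ^ b * (d ^ b * c₁)) ^ q ≡ n ^ (b * q) * (d ^ (b * q) * c₁ ^ q)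
  distrib = trans (^-distribʳ-* (n ^ b) (d ^ b * c₁) q)
    (cong₂ _*_ (^-*-assoc n b q) (trans (^-distribʳ-* (d ^ b) c₁ q) (cong (_* c₁ ^ q) (^-*-assoc d b q))))

-- A strictly larger exponent gains at least one factor `d`, which the constant `c` has to absorb.
base≤constant : ∀ {d c u v} w .{{_ : NonZero d}} → v < u → d ^ (w + u) ≤ c * d ^ (w + v) → d ≤ c
base≤constant {d} {c} {u} {v} w v<u le = *-cancelʳ-≤ d c (d ^ v) {{m^n≢0 d v}} (*-cancelˡ-≤ (d ^ w) {{m^n≢0 d w}} (begin
  d ^ w * d ^ suc v           ≤⟨ *-monoʳ-≤ (d ^ w) (^-monoʳ-≤ d v<u) ⟩
  d ^ w * d ^ u               ≡⟨ sym (^-distribˡ-+-* d w u) ⟩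
  d ^ (w + u)                 ≤⟨ le ⟩
  c * d ^ (w + v)             ≡⟨ cong (c *_) (^-distribˡ-+-* d w v) ⟩
  c * (d ^ w * d ^ v)         ≡⟨ x*yz≡y*xz c (d ^ w) (d ^ v) ⟩
  d ^ w * (c * d ^ v)         ∎))
  where
  open ≤-Reasoning

-- The parameters are m = 2k - 1 and h′ = ℓ - 1.
module Sharp (m h′ : ℕ) where

  private
    t = suc m
    h = suc h′
    -- The summands of `c₁` belong to the two terms of the trace bound, the second through
    -- `1 + d ≤ 2 * d`. In `c₂`, the 2 comes from `∑-concur-≥` and `h ^ h` from the number of
    -- colours.
    c₁ = 1 + 2 ^ t
    c₂ = 2 * h ^ h

  module _ (d : ℕ) .{{_ : NonZero d}} where

    private
      M = d ^ m
      instance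
        M≢0 : NonZero M
        M≢0 = m^n≢0 d m

    open Construction h′ M d using (labels; target; related; related-sym; related-irrefl; length-labels; hom-cycle-target-≤; hom-target-≥)

    n = length labels

    cycle-upper : M ^ t * hom (cycleG t) target ≤ n ^ t * (d ^ t * c₁)
    cycle-upper = *-cancelˡ-≤ (M ^ t) {{m^n≢0 M t}} (begin
      M ^ t * (M ^ t * hom (cycleG t) target)                ≡⟨ trans (sym (*-assoc (M ^ t) (M ^ t) _)) (cong (_* hom (cycleG t) target) (sym (^-distribʳ-* M M t))) ⟩
      (M * M) ^ t * hom (cycleG t) target                    ≤⟨ hom-cycle-target-≤ m ⟩
      -- `d * M` is `d ^ t` because `M = d ^ m` and `t = suc m`; this choice of `M` gives both terms
      -- the order `d ^ t * M ^ t`.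
      n ^ t * (d * M * M ^ t + (M + d * M) ^ t)              ≡⟨ cong (λ z → n ^ t * (d ^ t * M ^ t + z)) (trans (cong (_^ t) (factor M d)) (^-distribʳ-* (1 + d) M t)) ⟩
      n ^ t * (d ^ t * M ^ t + (1 + d) ^ t * M ^ t)          ≤⟨ *-monoʳ-≤ (n ^ t) (+-monoʳ-≤ (d ^ t * M ^ t) (*-monoˡ-≤ (M ^ t) (^-monoˡ-≤ t 1+d≤2d))) ⟩
      n ^ t * (d ^ t * M ^ t + (2 * d) ^ t * M ^ t)          ≡⟨ cong (λ z → n ^ t * (d ^ t * M ^ t + z * M ^ t)) (^-distribʳ-* 2 d t) ⟩
      n ^ t * (d ^ t * M ^ t + 2 ^ t * d ^ t * M ^ t)        ≡⟨ collect (n ^ t) (d ^ t) (M ^ t) (2 ^ t) ⟩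
      M ^ t * (n ^ t * (d ^ t * c₁))                         ∎)
      where
      open ≤-Reasoning
      factor : ∀ M d → M + d * M ≡ (1 + d) * M
      factor = solve-∀
      1+d≤2d : 1 + d ≤ 2 * d
      1+d≤2d = +-mono-≤ (>-nonZero⁻¹ d) (≤-reflexive (sym (+-identityʳ d)))
      collect : ∀ a b c e → a * (b * c + e * b * c) ≡ c * (a * (b * (1 + e)))
      collect = solve-∀

    hom-lower : (H : Graph h) → (∀ i → adj H i i ≡ false) → d ≤ M ^ h′ →
      d * n ^ h ≤ c₂ * M ^ h′ * hom H target
    hom-lower H H-irrefl d≤ = begin
      d * n ^ h                                ≡⟨ cong (λ z → d * z ^ h) length-labels ⟩
      d * (h * M ^ d) ^ h                      ≡⟨ cong (d *_) (^-distribʳ-* h (M ^ d) h) ⟩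
      d * (h ^ h * (M ^ d) ^ h)                ≡⟨ x*yz≡y*xz d (h ^ h) _ ⟩
      h ^ h * (d * (M ^ d) ^ h)                ≤⟨ *-monoʳ-≤ (h ^ h) (hom-target-≥ H H-irrefl d≤) ⟩
      h ^ h * (2 * M ^ h′ * hom H target)      ≡⟨ regroup (h ^ h) (M ^ h′) (hom H target) ⟩
      2 * h ^ h * M ^ h′ * hom H target        ∎
      where
      open ≤-Reasoning
      regroup : ∀ a b c → a * (2 * b * c) ≡ 2 * a * b * c
      regroup = solve-∀

    labels-nonempty : 0 < n
    labels-nonempty = subst (0 <_) (sym length-labels) (≤-trans (m^n>0 M d) (m≤m+n (M ^ d) (h′ * M ^ d)))

  -- With `M = d ^ m`, `combine` compares the exponents `p + m t q` and `m h′ p + t q` of `d`.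
  -- Removing the common part `p + t q` leaves `P q` against `p Q`; if the former were larger, `d`
  -- would be bounded by a constant.
  admissible⇒≤ : ∀ {P Q} → m * t ≡ P + t → m * h′ ≡ suc Q → 1 ≤ m → 1 ≤ h′ →
    (H : Graph h) → (∀ i → adj H i i ≡ false) → ∀ p q → Admissible (cycleG t) H p q → P * q ≤ p * Q
  admissible⇒≤ {P} {Q} mt mh 1≤m 1≤h′ H H-irrefl p q adm = ≮⇒≥ λ lt → <-irrefl refl (base≤constant {d} {c} (p + t * q) lt (begin
    d ^ (p + t * q + P * q)                    ≡⟨ cong (d ^_) left ⟩
    d ^ (p + m * (t * q))                      ≡⟨ ^-distribˡ-+-* d p (m * (t * q)) ⟩
    d ^ p * d ^ (m * (t * q))                  ≡⟨ cong (d ^ p *_) (sym (trans (^-*-assoc (d ^ m) t q) (^-*-assoc d m (t * q)))) ⟩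
    d ^ p * ((d ^ m) ^ t) ^ q                  ≤⟨ combine h t p q {{>-nonZero (labels-nonempty d)}} (hom-lower d H H-irrefl d≤) (cycle-upper d)
                                                   (admissible-graphOn {G = cycleG t} {H = H} {p} {q} adm labels related related-sym related-irrefl (labels-nonempty d)) ⟩
    c₂ ^ p * c₁ ^ q * (((d ^ m) ^ h′) ^ p * d ^ (t * q)) ≡⟨ cong (λ z → c * (z * d ^ (t * q))) (trans (^-*-assoc (d ^ m) h′ p) (^-*-assoc d m (h′ * p))) ⟩
    c * (d ^ (m * (h′ * p)) * d ^ (t * q))     ≡⟨ cong (c *_) (sym (^-distribˡ-+-* d (m * (h′ * p)) (t * q))) ⟩
    c * d ^ (m * (h′ * p) + t * q)             ≡⟨ cong (λ z → c * d ^ z) right ⟩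
    c * d ^ (p + t * q + p * Q)                ∎))
    where
    open ≤-Reasoning
    c = c₂ ^ p * c₁ ^ q
    -- One more than the constant `c`, so that `d ≤ c` is absurd.
    d = suc c
    open Construction h′ (d ^ m) d using (labels; related; related-sym; related-irrefl)
    left : p + t * q + P * q ≡ p + m * (t * q)
    left = trans (regroup p t q P) (cong (p +_) (trans (cong (_* q) (sym mt)) (*-assoc m t q)))
      where
      regroup : ∀ p t q P → p + t * q + P * q ≡ p + (P + t) * q
      regroup = solve-∀
    right : m * (h′ * p) + t * q ≡ p + t * q + p * Q
    right = trans (cong (_+ t * q) (trans (sym (*-assoc m h′ p)) (cong (_* p) mh))) (regroup p Q (t * q))
      where
      regroup : ∀ p Q z → suc Q * p + z ≡ p + z + p * Q
      regroup = solve-∀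
    d≤ : d ≤ (d ^ m) ^ h′
    d≤ = begin
      d               ≡⟨ sym (*-identityʳ d) ⟩
      d ^ 1           ≤⟨ ^-monoʳ-≤ d (*-mono-≤ 1≤m 1≤h′) ⟩
      d ^ (m * h′)    ≡⟨ sym (^-*-assoc d m h′) ⟩
      (d ^ m) ^ h′    ∎

-- The exponent in terms of `k` and `ℓ`

complement : ∀ e K → suc (suc e) ≤ 2 * suc K → e + (K + K ∸ e) ≡ K + K
complement e K ℓ≤2k = m+[n∸m]≡n (+-cancelˡ-≤ 2 e (K + K) (subst (2 + e ≤_) (double K) ℓ≤2k))
  where
  double : ∀ K → 2 * suc K ≡ 2 + (K + K)
  double = solve-∀

evenCycle-sharp : ∀ e g K → e + g ≡ K + K → (H : Graph (suc (suc e))) → (∀ i → adj H i i ≡ false) →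
  ∀ p q → Admissible (cycleG (2 * suc K)) H p q → 4 * suc K * K * q ≤ p * (g + e * (suc K + suc K))
-- `K + 1 * suc K` is `2k - 1`, in the form whose successor is `2 * suc K` by computation; `suc e`
-- is `ℓ - 1`.
evenCycle-sharp e g K eq = Sharp.admissible⇒≤ (K + 1 * suc K) (suc e) (mt K) mh
  (≤-trans (s≤s z≤n) (m≤n+m (1 * suc K) K)) (s≤s z≤n)
  where
  mt : ∀ K → (K + 1 * suc K) * (2 * suc K) ≡ 4 * suc K * K + 2 * suc K
  mt = solve-∀
  expand : ∀ K e → (K + 1 * suc K) * suc e ≡ 1 + (K + K + (K + 1 * suc K) * e)
  expand = solve-∀
  collect : ∀ e g K → 1 + (e + g + (K + 1 * suc K) * e) ≡ suc (g + e * (suc K + suc K))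
  collect = solve-∀
  mh : (K + 1 * suc K) * suc e ≡ suc (g + e * (suc K + suc K))
  mh = trans (expand K e) (trans (cong (λ z → 1 + (z + (K + 1 * suc K) * e)) (sym eq)) (collect e g K))

theorem4p2 : (k ℓ : ℕ) → 2 ≤ k → 2 ≤ ℓ → ℓ ≤ 2 * k →
    (H : Graph ℓ) → IsSimple H → HasHamiltonianCycle H →
    Admissible (cycleG (2 * k)) H (4 * k * (k ∸ 1)) (2 * k * ℓ ∸ 2 * k ∸ ℓ)
    × ((p q : ℕ) → 1 ≤ q →
    p * (2 * k * ℓ ∸ 2 * k ∸ ℓ) < 4 * k * (k ∸ 1) * q →
    ¬ Admissible (cycleG (2 * k)) H p q)
theorem4p2 (suc K) (suc (suc e)) _ (s≤s (s≤s _)) ℓ≤2k H (_ , H-irrefl) ham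
  -- With `k = suc K`, `ℓ = suc (suc e)` and `g = K + K ∸ e`, the truncated differences in both
  -- conjuncts become the subtraction-free denominator built from `e` and `g`.
  rewrite denominator e (K + K ∸ e) K (complement e K ℓ≤2k)
  = evenCycle-admissible e (K + K ∸ e) K (complement e K ℓ≤2k) H ham
  , λ p q _ lt adm → <⇒≱ lt (evenCycle-sharp e (K + K ∸ e) K (complement e K ℓ≤2k) H H-irrefl p q adm)
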